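{- Let $n=3M$, let $f(X_1,\dots,X_n)$ be the logical formula in Laurent form associated with a CNF formula with $M$ clauses of three literals each, and let $C$ be its constant term. Let $a_1,\dots,a_n,b_1,\dots,b_n$ be real numbers with frequencies $A_k,B_k$ and integerized frequencies $z'(A_k),z'(B_k)$ ($1\le k\le 3^n-1$). Let $l$ be a positive integer with $$\max_{1\le k\le 3^n-1}\{\max\{|z'(A_k)|,|z'(B_k)|\}\}<l .$$ Then $$\sum_{m_1=1}^{l}\sum_{m_2=1}^{l}\exp\Bigl(i\frac{2\pi z'(A_k)}{l}m_1\Bigr)\exp\Bigl(i\frac{2\pi z'(B_k)}{l}m_2\Bigr)=0\quad\text{for all }k,$$ and $$\sum_{m_1=1}^{l}\sum_{m_2=1}^{l}f=l^2C,$$ where in the $(m_1,m_2)$-th summand $f$ is evaluated at $X_j=\exp\bigl(i(z'(a_j)x+z'(b_j)y)\bigr)$ with $x=\frac{2\pi}{l}m_1$, $y=\frac{2\pi}{l}m_2$.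
   Context: The logical formula in Laurent form: given a CNF formula with $M$ clauses of three literals each and $N$ variables (the $s$-th one occurring $r_s\ge1$ times), number the literal occurrences $1,\dots,3M$ (clause $c$ consists of occurrences $3c-2,3c-1,3c$), assign to the $a$-th occurrence (positive or negated) a variable $X_a$, let $X_{st}$ be the variable assigned to the $t$-th occurrence of the $s$-th old variable, and $\varepsilon_{st}=1$ or $-1$ according to whether that occurrence is positive or negative. Then $$f=\frac{1}{2^{6M-1}}\prod_{c=1}^{M}\bigl((X_{3c-2}-1)(X_{3c-1}-1)(X_{3c}-1)+8\bigr)\prod_{s=1}^{N}\Bigl(\prod_{t=1}^{r_s}\bigl(\tfrac{\varepsilon_{st}}{X_{st}}+1\bigr)+\prod_{t=1}^{r_s}\bigl(-\tfrac{\varepsilon_{st}}{X_{st}}+1\bigr)\Bigr)-1 .$$ It expands as $f=\sum_{k=1}^{3^n-1}q_k\prod_{j=1}^nX_j^{e_j}+C$, where $k$ enumerates the non-zero vectors $(e_1,\dots,e_n)\in\{ -1,0,1\}^n$ and $C$ is the constant term. Frequencies: for the vector $(e_j)$ belonging to $k$, $A_k=\sum_je_ja_j$ and $B_k=\sum_je_jb_j$. The minimal maximum frequency is $\mu=\min_{1\le k\le 3^n-1}\{\max\{|A_k|,|B_k|\}\}$. Integerization $z'$: all $a_j,b_j$ are multiplied by one certain integer and rounded to integers $z'(a_j),z'(b_j)$; $z'(A_k)=\sum_je_jz'(a_j)$ and $z'(B_k)=\sum_je_jz'(b_j)$. The integerization $z'$ is such that frequencies with absolute value at least $\mu$ become non-zero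 integers: if $|A_k|\ge\mu$ then $z'(A_k)\ne0$, and if $|B_k|\ge\mu$ then $z'(B_k)\neq0$. -}

module Defs where

open import Level using (0ℓ; suc; _⊔_)
open import Algebra.Apartness.Bundles using (HeytingField; HeytingCommutativeRing)
open import Algebra.Bundles using (RawRing; CommutativeRing)
import Algebra.Definitions
import Algebra.Definitions.RawMonoid as RawMonoidDefs
import Algebra.Definitions.RawSemiring as RawSemiringDefs
open import Data.Fin.Base using (Fin; toℕ; combine; remQuot)
open import Data.Fin.Patterns using (0F; 1F; 2F)
open import Data.Fin.Properties using () renaming (_≟_ to _≟ᶠ_)
open import Data.Integer.Base as ℤ using (ℤ; 0ℤ; 1ℤ; -1ℤ)
import Data.Integer.Properties as ℤ
open import Data.List.Base using (List; []; _∷_; _++_; map; filter; foldr; allFin; cartesianProductWith)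
import Data.List.Extrema.Nat as ℕExtrema
open import Data.List.Membership.Propositional using (_∈_)
open import Data.Nat.Base as ℕ using (ℕ; _!)
import Data.Nat.Properties as ℕ
open import Data.Product.Base using (∃-syntax; ∃₂; _×_; _,_; proj₁; proj₂)
open import Data.Rational.Base as ℚ using (ℚ; 0ℚ; 1ℚ; ½; ↥_; ↧ₙ_)
open import Data.Sign.Base using (Sign)
open import Data.Sum.Base using (_⊎_)
open import Data.Vec.Base using (Vec; []; _∷_; lookup; replicate; zipWith; tabulate)
open import Data.Vec.Properties using (≡-dec)
open import Relation.Binary.Core using (Rel)
open import Relation.Binary.Lattice.Definitions using (Supremum; Infimum)
open import Relation.Binary.PropositionalEquality.Core using (_≡_; _≢_)
open import Relation.Binary.Structures using (IsStrictPartialOrder)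
open import Relation.Nullary.Decidable using (yes; no; ¬?)
open import Relation.Nullary.Negation using (¬_)

-- ℝ is given axiomatically, as a Cauchy-complete Archimedean ordered field.
-- Classically these axioms determine ℝ up to isomorphism.  Equality and order
-- are not assumed decidable, so that the axioms hold constructively as well
-- (e.g. for Bishop's reals).
record Reals c ℓ₁ ℓ₂ : Set (suc (c ⊔ ℓ₁ ⊔ ℓ₂)) where
  infix  4 _<_ _≤_
  infixr 6 _∨_
  infixr 7 _∧_
  field
    heytingField : HeytingField c ℓ₁ ℓ₂
  open HeytingField heytingField public
    renaming (Carrier to ℝ)
  field
    _<_                  : Rel ℝ ℓ₂
    isStrictPartialOrder : IsStrictPartialOrder _≈_ _<_
    #⇒<⊎>                : ∀ {x y} → x # y → x < y ⊎ y < x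
    <⇒#                  : ∀ {x y} → x < y → x # y
    0<1                  : 0# < 1#
    +-monoˡ-<            : ∀ z {x y} → x < y → x + z < y + z
    *-pos                : ∀ {x y} → 0# < x → 0# < y → 0# < x * y

  _≤_ : Rel ℝ ℓ₂
  x ≤ y = ¬ (y < x)

  field
    _∨_ _∧_ : ℝ → ℝ → ℝ
    ∨-sup   : Supremum _≤_ _∨_
    ∧-inf   : Infimum _≤_ _∧_

  ∣_∣ : ℝ → ℝ
  ∣ x ∣ = x ∨ (- x)

  open HeytingCommutativeRing heytingCommutativeRing public
    using (commutativeRing)
  open CommutativeRing commutativeRing public
    using (+-rawMonoid)
  open RawMonoidDefs +-rawMonoid public
    using () renaming (_×_ to _times_; sum to sumℝ)

  fromℕ : ℕ → ℝ
  fromℕ n = n times 1#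

  Converges : (ℕ → ℝ) → ℝ → Set (c ⊔ ℓ₂)
  Converges s x = ∀ ε → 0# < ε → ∃[ N ] (∀ n → N ℕ.≤ n → ∣ s n - x ∣ < ε)

  Cauchy : (ℕ → ℝ) → Set (c ⊔ ℓ₂)
  Cauchy s = ∀ ε → 0# < ε → ∃[ N ] (∀ m n → N ℕ.≤ m → N ℕ.≤ n → ∣ s m - s n ∣ < ε)

  field
    archimedean : ∀ x → ∃[ n ] (x < fromℕ n)
    complete    : ∀ s → Cauchy s → ∃[ x ] Converges s x

  private
    module < = IsStrictPartialOrder isStrictPartialOrder

  0<fromℕ : ∀ n .{{_ : ℕ.NonZero n}} → 0# < fromℕ n
  0<fromℕ 1 = proj₁ <.<-resp-≈ (sym (+-identityʳ 1#)) 0<1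
  0<fromℕ (ℕ.suc (ℕ.suc n)) =
    <.trans (0<fromℕ (ℕ.suc n))
      (proj₂ <.<-resp-≈ (+-identityˡ _) (+-monoˡ-< (fromℕ (ℕ.suc n)) 0<1))

  1/fromℕ : ∀ n .{{_ : ℕ.NonZero n}} → ℝ
  1/fromℕ n = proj₁ (#⇒invertible (#-sym (<⇒# (0<fromℕ n))))

  fromℤ : ℤ → ℝ
  fromℤ (ℤ.+ n)      = fromℕ n
  fromℤ (ℤ.-[1+ n ]) = - fromℕ (ℕ.suc n)

  fromℚ : ℚ → ℝ
  fromℚ q = fromℤ (↥ q) * 1/fromℕ (↧ₙ q)

-- A finite formal sum of terms q·X₁^e₁⋯Xₙ^eₙ; the same exponent vector may
-- occur in several terms, so equality is equality of all coefficients.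
Laurent : ℕ → Set
Laurent n = List (ℚ × Vec ℤ n)

coefficient : ∀ {n} → Vec ℤ n → Laurent n → ℚ
coefficient e [] = 0ℚ
coefficient e ((q , d) ∷ f) with ≡-dec ℤ._≟_ d e
... | yes _ = q ℚ.+ coefficient e f
... | no  _ = coefficient e f

constantTerm : ∀ {n} → Laurent n → ℚ
constantTerm {n} = coefficient (replicate n 0ℤ)

const : ∀ {n} → ℚ → Laurent n
const {n} q = (q , replicate n 0ℤ) ∷ []

power : ∀ {n} → Fin n → ℤ → Laurent n
power j k = (1ℚ , tabulate exponent) ∷ []
  where
  exponent : Fin _ → ℤ
  exponent i with i ≟ᶠ j
  ... | yes _ = k
  ... | no  _ = 0ℤ

laurentRing : ℕ → RawRing 0ℓ 0ℓ
laurentRing n = record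
  { Carrier = Laurent n
  ; _≈_     = λ f g → ∀ e → coefficient e f ≡ coefficient e g
  ; _+_     = _++_
  ; _*_     = cartesianProductWith λ { (p , d) (q , e) → p ℚ.* q , zipWith ℤ._+_ d e }
  ; -_      = map λ { (q , e) → ℚ.- q , e }
  ; 0#      = []
  ; 1#      = const 1ℚ
  }

record Literal (N : ℕ) : Set where
  field
    variable′ : Fin N
    sign      : Sign

record 3CNF (M N : ℕ) : Set where
  field
    literal : Fin M → Fin 3 → Literal N
    occurs  : ∀ s → ∃₂ λ c p → Literal.variable′ (literal c p) ≡ s

-- The literal in position p of clause c is occurrence number
-- combine c p : Fin (M * 3), i.e. (counting from zero) 3c + p.
logicalForm : ∀ {M N} → 3CNF M N → Laurent (M ℕ.* 3)
logicalForm {M} {N} φ =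
  const ((ℤ.+ 1 ℚ./ (2 ℕ.^ k)) {{ℕ.m^n≢0 2 k}})
    * product clause * product oldVariable - const 1ℚ
  where
  k = 6 ℕ.* M ℕ.∸ 1
  n = M ℕ.* 3

  open RawRing (laurentRing n)
  open RawSemiringDefs rawSemiring using (product)

  infixl 6 _-_
  _-_ : Laurent n → Laurent n → Laurent n
  f - g = f + (- g)

  literalAt : Fin n → Literal N
  literalAt a = let c , p = remQuot 3 a in 3CNF.literal φ c p

  clause : Fin M → Laurent n
  clause c = (X₁ - 1#) * (X₂ - 1#) * (X₃ - 1#) + const (ℤ.+ 8 ℚ./ 1)
    where
    X₁ = power (combine c 0F) 1ℤ
    X₂ = power (combine c 1F) 1ℤ
    X₃ = power (combine c 2F) 1ℤ

  occurrences : Fin N → List (Fin n)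
  occurrences s = filter (λ a → Literal.variable′ (literalAt a) ≟ᶠ s) (allFin n)

  ε/X : Fin n → Laurent n
  ε/X a = const ((Literal.sign (literalAt a) ℤ.◃ 1) ℚ./ 1) * power a -1ℤ

  oldVariable : Fin N → Laurent n
  oldVariable s =
      foldr (λ a f → (ε/X a + 1#) * f) 1# (occurrences s)
    + foldr (λ a f → (- ε/X a + 1#) * f) 1# (occurrences s)

signVectors : ∀ n → List (Vec ℤ n)
signVectors ℕ.zero    = [] ∷ []
signVectors (ℕ.suc n) = cartesianProductWith _∷_ (-1ℤ ∷ 0ℤ ∷ 1ℤ ∷ []) (signVectors n)

-- The 3ⁿ - 1 non-zero vectors in {-1,0,1}ⁿ; these play the role of the index k.
freqVectors : ∀ n → List (Vec ℤ n)
freqVectors n = filter (λ e → ¬? (≡-dec ℤ._≟_ e (replicate n 0ℤ))) (signVectors n)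

freqℤ : ∀ {n} → (Fin n → ℤ) → Vec ℤ n → ℤ
freqℤ z e = RawMonoidDefs.sum ℤ.+-0-rawMonoid (λ j → lookup e j ℤ.* z j)

maxFreqℤ : ∀ {n} → (Fin n → ℤ) → (Fin n → ℤ) → ℕ
maxFreqℤ {n} za zb =
  ℕExtrema.max 0 (map (λ e → ℤ.∣ freqℤ za e ∣ ℕ.⊔ ℤ.∣ freqℤ zb e ∣) (freqVectors n))

module Analysis {c ℓ₁ ℓ₂} (R : Reals c ℓ₁ ℓ₂) where

  open Reals R

  freq : ∀ {n} → (Fin n → ℝ) → Vec ℤ n → ℝ
  freq a e = sumℝ (λ j → fromℤ (lookup e j) * a j)

  -- The minimum is seeded with the value at (1,…,1), which for n ≥ 1 is itself
  -- one of the non-zero vectors.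
  minMaxFreq : ∀ {n} → (Fin n → ℝ) → (Fin n → ℝ) → ℝ
  minMaxFreq {n} a b = foldr _∧_ (amplitude (replicate n 1ℤ)) (map amplitude (freqVectors n))
    where
    amplitude : Vec ℤ n → ℝ
    amplitude e = ∣ freq a e ∣ ∨ ∣ freq b e ∣

  -- Nearest integer; either choice is allowed at a tie.
  RoundsTo : ℝ → ℤ → Set ℓ₂
  RoundsTo x z = ∣ x - fromℤ z ∣ ≤ fromℚ ½

  record IsIntegerization {n} (a b : Fin n → ℝ) (za zb : Fin n → ℤ) : Set ℓ₂ where
    field
      multiplier : ℤ
      rounds-a   : ∀ j → RoundsTo (fromℤ multiplier * a j) (za j)
      rounds-b   : ∀ j → RoundsTo (fromℤ multiplier * b j) (zb j)
      nonzero-a  : ∀ e → e ∈ freqVectors n → minMaxFreq a b ≤ ∣ freq a e ∣ → freqℤ za e ≢ 0ℤ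
      nonzero-b  : ∀ e → e ∈ freqVectors n → minMaxFreq a b ≤ ∣ freq b e ∣ → freqℤ zb e ≢ 0ℤ

  infix 5 _+i_
  record ℂ : Set c where
    constructor _+i_
    field
      re im : ℝ
  open ℂ public

  complexRing : RawRing c ℓ₁
  complexRing = record
    { Carrier = ℂ
    ; _≈_     = λ z w → re z ≈ re w × im z ≈ im w
    ; _+_     = λ z w → re z + re w +i im z + im w
    ; _*_     = λ z w → re z * re w - im z * im w +i re z * im w + im z * re w
    ; -_      = λ z → - re z +i - im z
    ; 0#      = 0# +i 0#
    ; 1#      = 1# +i 0#
    }

  open RawRing complexRing public
    using () renaming (_≈_ to _≈ᶜ_; _*_ to _*ᶜ_; 0# to 0ᶜ; 1# to 1ᶜ)
  open RawSemiringDefs (RawRing.rawSemiring complexRing) public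
    using () renaming (sum to sumᶜ; product to productᶜ; _^_ to _^ᶜ_)

  fromℝ : ℝ → ℂ
  fromℝ x = x +i 0#

  IsExponential : (ℂ → ℂ) → Set (c ⊔ ℓ₂)
  IsExponential exp = ∀ z →
    Converges (λ n → re (partialSum z n)) (re (exp z)) ×
    Converges (λ n → im (partialSum z n)) (im (exp z))
    where
    partialSum : ℂ → ℕ → ℂ
    partialSum z n = sumᶜ {n} λ k → fromℝ (1/fromℕ (toℕ k !) {{toℕ k ℕ.!≢0}}) *ᶜ z ^ᶜ toℕ k

  -- π/2 is the least positive zero of the cosine.
  record IsPi (exp : ℂ → ℂ) (π : ℝ) : Set (c ⊔ ℓ₁ ⊔ ℓ₂) where
    cos : ℝ → ℝ
    cos θ = re (exp (0# +i θ))
    field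
      positive : 0# < π
      cos-π/2  : cos (fromℚ ½ * π) ≈ 0#
      least    : ∀ θ → 0# < θ → θ < fromℚ ½ * π → ¬ (cos θ ≈ 0#)

  IsUnit : ℂ → Set (c ⊔ ℓ₁)
  IsUnit = Algebra.Definitions.Invertible _≈ᶜ_ 1ᶜ _*ᶜ_

  zpow : (z : ℂ) → IsUnit z → ℤ → ℂ
  zpow z _         (ℤ.+ k)      = z ^ᶜ k
  zpow z (z⁻¹ , _) (ℤ.-[1+ k ]) = z⁻¹ ^ᶜ ℕ.suc k

  eval : ∀ {n} → Laurent n → (X : Fin n → ℂ) → (∀ j → IsUnit (X j)) → ℂ
  eval f X unit = foldr (λ t → RawRing._+_ complexRing (term t)) 0ᶜ f
    where
    term : ℚ × Vec ℤ _ → ℂ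
    term (q , e) = fromℝ (fromℚ q) *ᶜ productᶜ (λ j → zpow (X j) (unit j) (lookup e j))

  Σ₁ : ℕ → (ℕ → ℂ) → ℂ
  Σ₁ l g = sumᶜ {l} (λ i → g (ℕ.suc (toℕ i)))

  syntax Σ₁ l (λ m → z) = Σ₁[ m ≤ l ] z

-- At the grid points the monomial ∏ X_j^e_j equals ω^(A m₁) ω^(B m₂) with ω = e^(2πi/l), so its double
-- sum is a product of two geometric sums.  Since |A|, |B| < l, such a sum vanishes as soon as the integer
-- frequency is non-zero, and the integerization forces A ≠ 0 or B ≠ 0 for e ≠ 0 because
-- μ ≤ max(|A_k|, |B_k|).  In the logical form X_j occurs once in the first product (exponent 0 or 1) and once
-- in the second (exponent 0 or -1), so every term other than the constant ones has a frequency vector.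
--
-- The analysis needed is exp(z + w) = exp z exp w and e^(2πik/l) ≠ 1 for 0 < |k| < l.  The former follows from
-- the Cauchy product, whose remainder is dominated by a real one that is squeezed by E₂ₙ - Eₙ.  For the latter,
-- e^(4ix) = 1 with 0 < x < π/2 gives sin 2x = 0, hence sin x = 0, and halving x repeatedly contradicts
-- sin x ≥ x - 4x² near 0.  Equality and ≤ are stable under double negation, so classical case
-- distinctions are available in proving them.

{-# OPTIONS --safe #-}
module Submission where

open import Defs
open import Algebra.Bundles using (CommutativeRing; RawRing)
import Algebra.Apartness.Properties.HeytingCommutativeRing
import Algebra.Definitions.RawMonoid
import Algebra.Definitions.RawSemiring
import Algebra.Properties.CommutativeSemiring.Binomial
import Algebra.Properties.Ring
import Algebra.Properties.Semiring.Exp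
import Algebra.Properties.Semiring.Mult
import Algebra.Properties.Semiring.Mult.TCOptimised
import Algebra.Properties.Semiring.Sum
import Algebra.Solver.Ring
open import Algebra.Solver.Ring.AlmostCommutativeRing
  using (fromCommutativeRing; _-Raw-AlmostCommutative⟶_)
open import Data.Empty using (⊥; ⊥-elim)
open import Data.Fin.Base as Fin using (Fin; toℕ; combine; remQuot)
open import Data.Fin.Patterns using (0F; 1F; 2F)
import Data.Fin.Properties as Fin
open import Data.Integer.Base as ℤ using (ℤ; 0ℤ; 1ℤ; -1ℤ)
import Data.Integer.Properties as ℤ
open import Data.List.Base using (List; []; _∷_; map; foldr; filter; allFin; cartesianProductWith)
import Data.List.Extrema.Nat as Extrema
open import Data.List.Membership.Propositional using (_∈_)
open import Data.List.Membership.Propositional.Properties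
  using (∈-cartesianProductWith⁺; ∈-filter⁺; ∈-filter⁻; ∈-map⁺)
open import Data.List.Relation.Unary.All as All using (All; []; _∷_)
import Data.List.Relation.Unary.All.Properties as All
open import Data.List.Relation.Unary.AllPairs using ([]; _∷_)
open import Data.List.Relation.Unary.Any using (here; there)
open import Data.List.Relation.Unary.Unique.Propositional using (Unique)
import Data.List.Relation.Unary.Unique.Propositional.Properties as Unique
open import Data.Maybe.Base using (Maybe; just; nothing)
import Data.Nat.Base as ℕ
open import Data.Nat.Base using (ℕ; NonZero; zero; suc; _!)
open import Data.Nat.Combinatorics using (_C_; nCk≡n!/k![n-k]!; k![n∸k]!∣n!)
import Data.Nat.DivMod as ℕ
import Data.Nat.Properties as ℕ
open import Data.Product.Base using (∃-syntax; Σ-syntax; _×_; _,_; proj₁; proj₂)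
open import Data.Rational.Base as ℚ using (ℚ; ½; ↥_; ↧_; ↧ₙ_)
import Data.Rational.Properties as ℚ
import Data.Rational.Unnormalised.Base as ℚᵘ
open import Data.Sign.Base as Sign using ()
open import Data.Sum.Base using (_⊎_; inj₁; inj₂)
open import Data.Vec.Base using (Vec; []; _∷_; lookup; replicate; tabulate; zipWith)
open import Data.Vec.Properties using (≡-dec; lookup-replicate; lookup-zipWith; lookup∘tabulate)
open import Function.Base using (_∘_)
open import Relation.Binary.PropositionalEquality.Core as ≡ using (_≡_; _≢_)
import Relation.Binary.Reasoning.Setoid
open import Relation.Binary.Structures using (IsStrictPartialOrder)
open import Relation.Nullary.Decidable using (yes; no; ¬?)
open import Relation.Nullary.Negation using (¬_)

-- The function `exp` and the number π are given only by their defining properties, and what is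
-- known of π ends at π/2, the first positive zero of the cosine. This is why the angles 2πk/l are
-- quartered: for 0 < k < l the quarter (π/2)(k/l) lies strictly between 0 and π/2, where the cosine
-- cannot vanish. That the sine does not vanish there either has to be derived. An argument by
-- monotonicity would need derivatives; the duplication formula instead carries nonvanishing outward
-- from a neighbourhood of 0, where a crude estimate of the series settles it. Nonvanishing is
-- recorded as a negated equality rather than as apartness. This is enough, because it only serves
-- to cancel a factor in an equation, and equality is stable.

nCk*[k!*[n∸k]!]≡n! : ∀ {n k} → k ℕ.≤ n → (n C k) ℕ.* (k ! ℕ.* (n ℕ.∸ k) !) ≡ n !
nCk*[k!*[n∸k]!]≡n! {n} {k} k≤n = ≡.trans
  (≡.cong (ℕ._* (k ! ℕ.* (n ℕ.∸ k) !)) (nCk≡n!/k![n-k]! k≤n))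
  (ℕ.m/n*n≡m {{ℕ.m*n≢0 (k !) ((n ℕ.∸ k) !) {{k ℕ.!≢0}} {{(n ℕ.∸ k) ℕ.!≢0}}}} (k![n∸k]!∣n! k≤n))

-- Finite sums, Cauchy products and exponential terms over a commutative ring.

module CommutativeRingLemmas {c ℓ} (A : CommutativeRing c ℓ) where
  open CommutativeRing A
  open Algebra.Properties.Semiring.Mult semiring public
    using (×-homo-+; ×1-homo-*; ×-congʳ; ×-assoc-*) renaming (_×_ to _⋅_)
  open Algebra.Properties.Semiring.Sum semiring public
    using (sum; sum-cong-≋; *-distribˡ-sum; ∑-distrib-+; *-distribʳ-sum)
  open Algebra.Properties.Semiring.Exp semiring public using (_^_; ^-congˡ)
  private
    module TC = Algebra.Properties.Semiring.Mult.TCOptimised semiring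
    module Binomial = Algebra.Properties.CommutativeSemiring.Binomial commutativeSemiring
    module Neg = Algebra.Properties.Ring ring
  open import Relation.Binary.Reasoning.Setoid setoid

  -- The canonical map from the integers. It provides the coefficient homomorphism of the ring
  -- solver and, over the reals, the additivity and multiplicativity of `fromℤ`.
  ι : ℤ → Carrier
  ι (ℤ.+ n)      = n ⋅ 1#
  ι (ℤ.-[1+ n ]) = - (suc n ⋅ 1#)

  private
    cancel-1 : ∀ x y → x - y ≈ (1# + x) - (1# + y)
    cancel-1 x y = begin
      x - y                     ≈⟨ +-congʳ (+-identityˡ x) ⟨
      0# + x - y                ≈⟨ +-congʳ (+-congʳ (-‿inverseʳ 1#)) ⟨
      1# - 1# + x - y           ≈⟨ +-congʳ (trans (+-assoc _ _ _) (trans (+-congˡ (+-comm _ _)) (sym (+-assoc _ _ _)))) ⟩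
      1# + x - 1# - y           ≈⟨ +-assoc _ _ _ ⟩
      1# + x + (- 1# - y)       ≈⟨ +-congˡ (Neg.-‿+-comm 1# y) ⟩
      (1# + x) - (1# + y)       ∎

  ι-⊖ : ∀ m n → ι (m ℤ.⊖ n) ≈ m ⋅ 1# - n ⋅ 1#
  ι-⊖ zero    zero    = sym (-‿inverseʳ 0#)
  ι-⊖ zero    (suc n) = sym (+-identityˡ _)
  ι-⊖ (suc m) zero    = sym (trans (+-congˡ Neg.-0#≈0#) (+-identityʳ _))
  ι-⊖ (suc m) (suc n) = begin
    ι (suc m ℤ.⊖ suc n)    ≡⟨ ≡.cong ι (ℤ.[1+m]⊖[1+n]≡m⊖n m n) ⟩
    ι (m ℤ.⊖ n)            ≈⟨ ι-⊖ m n ⟩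
    m ⋅ 1# - n ⋅ 1#        ≈⟨ cancel-1 _ _ ⟩
    suc m ⋅ 1# - suc n ⋅ 1# ∎

  ι-+ : ∀ i j → ι (i ℤ.+ j) ≈ ι i + ι j
  ι-+ (ℤ.+ m)    (ℤ.+ n)    = ×-homo-+ 1# m n
  ι-+ (ℤ.+ m)    ℤ.-[1+ n ] = ι-⊖ m (suc n)
  ι-+ ℤ.-[1+ m ] (ℤ.+ n)    = trans (ι-⊖ n (suc m)) (+-comm _ _)
  ι-+ ℤ.-[1+ m ] ℤ.-[1+ n ] = begin
    - (suc (suc (m ℕ.+ n)) ⋅ 1#)      ≡⟨ ≡.cong (λ k → - (suc k ⋅ 1#)) (ℕ.+-suc m n) ⟨
    - ((suc m ℕ.+ suc n) ⋅ 1#)        ≈⟨ -‿cong (×-homo-+ 1# (suc m) (suc n)) ⟩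
    - (suc m ⋅ 1# + suc n ⋅ 1#)       ≈⟨ Neg.-‿+-comm _ _ ⟨
    - (suc m ⋅ 1#) - suc n ⋅ 1#       ∎

  ι-neg : ∀ i → ι (ℤ.- i) ≈ - ι i
  ι-neg (ℤ.+ zero)  = sym Neg.-0#≈0#
  ι-neg ℤ.+[1+ n ]  = refl
  ι-neg ℤ.-[1+ n ]  = sym (Neg.-‿involutive _)

  private
    ι-+◃ : ∀ n → ι (Sign.+ ℤ.◃ n) ≈ n ⋅ 1#
    ι-+◃ n = reflexive (≡.cong ι (ℤ.+◃n≡+n n))

    ι--◃ : ∀ n → ι (Sign.- ℤ.◃ n) ≈ - (n ⋅ 1#)
    ι--◃ n = trans (reflexive (≡.cong ι (ℤ.-◃n≡-n n))) (ι-neg (ℤ.+ n))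

  ι-* : ∀ i j → ι (i ℤ.* j) ≈ ι i * ι j
  ι-* (ℤ.+ m)    (ℤ.+ n)    = trans (ι-+◃ (m ℕ.* n)) (×1-homo-* m n)
  ι-* (ℤ.+ m)    ℤ.-[1+ n ] = trans (ι--◃ (m ℕ.* suc n))
    (trans (-‿cong (×1-homo-* m (suc n))) (Neg.-‿distribʳ-* _ _))
  ι-* ℤ.-[1+ m ] (ℤ.+ n)    = trans (ι--◃ (suc m ℕ.* n))
    (trans (-‿cong (×1-homo-* (suc m) n)) (Neg.-‿distribˡ-* _ _))
  ι-* ℤ.-[1+ m ] ℤ.-[1+ n ] = trans (×1-homo-* (suc m) (suc n))
    (sym (trans (sym (Neg.-‿distribˡ-* _ _))
      (trans (-‿cong (sym (Neg.-‿distribʳ-* _ _))) (Neg.-‿involutive _))))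

  private
    -- With this form of multiples `con 1ℤ` evaluates to `1#` itself and not to `1# + 0#`, so that
    -- solver equations match the goals literally.
    ι′ : ℤ → Carrier
    ι′ (ℤ.+ n)      = n TC.× 1#
    ι′ (ℤ.-[1+ n ]) = - (suc n TC.× 1#)

    ι′≈ι : ∀ i → ι′ i ≈ ι i
    ι′≈ι (ℤ.+ n)    = sym (TC.×ᵤ≈× n 1#)
    ι′≈ι ℤ.-[1+ n ] = -‿cong (sym (TC.×ᵤ≈× (suc n) 1#))

    morphism : ℤ.+-*-rawRing -Raw-AlmostCommutative⟶ fromCommutativeRing A
    morphism = record
      { ⟦_⟧    = ι′
      ; +-homo = λ i j → trans (ι′≈ι (i ℤ.+ j)) (trans (ι-+ i j) (sym (+-cong (ι′≈ι i) (ι′≈ι j))))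
      ; *-homo = λ i j → trans (ι′≈ι (i ℤ.* j)) (trans (ι-* i j) (sym (*-cong (ι′≈ι i) (ι′≈ι j))))
      ; -‿homo = λ i → trans (ι′≈ι (ℤ.- i)) (trans (ι-neg i) (sym (-‿cong (ι′≈ι i))))
      ; 0-homo = refl
      ; 1-homo = refl
      }

    _ι′≟_ : ∀ i j → Maybe (ι′ i ≈ ι′ j)
    i ι′≟ j with i ℤ.≟ j
    ... | yes i≡j = just (reflexive (≡.cong ι′ i≡j))
    ... | no  _   = nothing

  module Solver = Algebra.Solver.Ring ℤ.+-*-rawRing (fromCommutativeRing A) morphism _ι′≟_
  open Solver using (solve; con; _:+_; _:*_; _:-_; :-_; _:=_)

  ∑ : (ℕ → Carrier) → ℕ → Carrier
  ∑ u n = sum {n} (u ∘ toℕ)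

  ∑-cong : ∀ {u v} n → (∀ k → u k ≈ v k) → ∑ u n ≈ ∑ v n
  ∑-cong n u≈v = sum-cong-≋ {n} (λ i → u≈v (toℕ i))

  ∑-last : ∀ u n → ∑ u (suc n) ≈ ∑ u n + u n
  ∑-last u zero    = +-comm _ _
  ∑-last u (suc n) = trans (+-congˡ (∑-last (u ∘ suc) n)) (sym (+-assoc _ _ _))

  ∑-++ : ∀ u m n → ∑ u (m ℕ.+ n) ≈ ∑ u m + ∑ (u ∘ (m ℕ.+_)) n
  ∑-++ u zero    n = sym (+-identityˡ _)
  ∑-++ u (suc m) n = trans (+-congˡ (∑-++ (u ∘ suc) m n)) (sym (+-assoc _ _ _))

  *-distribˡ-∑ : ∀ x u n → x * ∑ u n ≈ ∑ (λ k → x * u k) n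
  *-distribˡ-∑ x u n = *-distribˡ-sum {n} x (u ∘ toℕ)

  ∑-telescope : ∀ u n → ∑ (λ k → u k - u (suc k)) n ≈ u 0 - u n
  ∑-telescope u zero    = sym (-‿inverseʳ (u 0))
  ∑-telescope u (suc n) = trans (+-congˡ (∑-telescope (u ∘ suc) n))
    (solve 3 (λ x y z → (x :- y) :+ (y :- z) := x :- z) refl (u 0) (u 1) (u (suc n)))

  -- The n-th coefficient of the Cauchy product. Shifting `u` gives it the same recursion as
  -- `triangle`; the closed form in `conv-sum` is the one to which the binomial theorem applies.
  conv : (ℕ → Carrier) → (ℕ → Carrier) → ℕ → Carrier
  conv u v zero    = u 0 * v 0
  conv u v (suc n) = u 0 * v (suc n) + conv (u ∘ suc) v n

  conv-sum : ∀ u v n → conv u v n ≈ sum {suc n} (λ k → u (toℕ k) * v (n ℕ.∸ toℕ k))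
  conv-sum u v zero    = sym (+-identityʳ _)
  conv-sum u v (suc n) = +-congˡ (conv-sum (u ∘ suc) v n)

  -- The sum of u j * v k over j + k < n.
  triangle : (ℕ → Carrier) → (ℕ → Carrier) → ℕ → Carrier
  triangle u v zero    = 0#
  triangle u v (suc n) = u 0 * ∑ v (suc n) + triangle (u ∘ suc) v n

  -- Enlarging the triangle by one adds exactly the antidiagonal j + k = n.
  triangle-last : ∀ u v n → triangle u v (suc n) ≈ triangle u v n + conv u v n
  triangle-last u v zero    =
    solve 2 (λ x y → x :* (y :+ con ℤ.0ℤ) :+ con ℤ.0ℤ := con ℤ.0ℤ :+ x :* y) refl (u 0) (v 0)
  triangle-last u v (suc n) = trans
    (+-cong (*-congˡ (∑-last v (suc n))) (triangle-last (u ∘ suc) v n))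
    (solve 5 (λ x s y t c → x :* (s :+ y) :+ (t :+ c) := (x :* s :+ t) :+ (x :* y :+ c)) refl
      (u 0) (∑ v (suc n)) (v (suc n)) (triangle (u ∘ suc) v n) (conv (u ∘ suc) v n))

  triangle≈∑conv : ∀ u v n → triangle u v n ≈ ∑ (conv u v) n
  triangle≈∑conv u v zero    = refl
  triangle≈∑conv u v (suc n) = trans (triangle-last u v n)
    (trans (+-congʳ (triangle≈∑conv u v n)) (sym (∑-last (conv u v) n)))

  -- The sum of u j * v k over j < n, k < n + d, j + k ≥ n.
  corner : (ℕ → Carrier) → (ℕ → Carrier) → ℕ → ℕ → Carrier
  corner u v zero    d = 0#
  corner u v (suc n) d = u 0 * ∑ (v ∘ (suc n ℕ.+_)) d + corner (u ∘ suc) v n (suc d)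

  -- Removing the row of `u 0` lowers n but keeps the number of columns `n + d`, so the induction
  -- has to let the surplus d grow. The square is the case d = 0.
  ∑*∑-corner : ∀ u v n d → ∑ u n * ∑ v (n ℕ.+ d) ≈ triangle u v n + corner u v n d
  ∑*∑-corner u v zero    d = trans (zeroˡ _) (sym (+-identityˡ 0#))
  ∑*∑-corner u v (suc n) d = begin
    (u 0 + U) * ∑ v (suc n ℕ.+ d)
      ≈⟨ distribʳ _ _ _ ⟩
    u 0 * ∑ v (suc n ℕ.+ d) + U * ∑ v (suc n ℕ.+ d)
      ≈⟨ +-cong (*-congˡ (∑-++ v (suc n) d)) (*-congˡ (reflexive (≡.cong (∑ v) (≡.sym (ℕ.+-suc n d))))) ⟩
    u 0 * (V + W) + U * ∑ v (n ℕ.+ suc d)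
      ≈⟨ +-congˡ (∑*∑-corner (u ∘ suc) v n (suc d)) ⟩
    u 0 * (V + W) + (T + K)
      ≈⟨ solve 5 (λ x v w t k → x :* (v :+ w) :+ (t :+ k) := (x :* v :+ t) :+ (x :* w :+ k)) refl (u 0) V W T K ⟩
    (u 0 * V + T) + (u 0 * W + K) ∎
    where
    U = ∑ (u ∘ suc) n
    V = ∑ v (suc n)
    W = ∑ (v ∘ (suc n ℕ.+_)) d
    T = triangle (u ∘ suc) v n
    K = corner (u ∘ suc) v n (suc d)

  -- The inverse factorials are a parameter so that one computation serves both the complex series
  -- and the real series that dominates it.
  module ExponentialTerms (r : ℕ → Carrier) (r-inverse : ∀ k → r k * ((k !) ⋅ 1#) ≈ 1#) where

    term : Carrier → ℕ → Carrier
    term x k = r k * x ^ k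

    -- Instead of dividing, one inserts k!/k! and (n-k)!/(n-k)!, both equal to 1; the two factorials
    -- in the numerators combine with the binomial coefficient to n!, which `r n` cancels.
    r-binomial : ∀ {n k} → k ℕ.≤ n → r n * ((n C k) ⋅ 1#) ≈ r k * r (n ℕ.∸ k)
    r-binomial {n} {k} k≤n = begin
      r n * B
        ≈⟨ solve 2 (λ x y → x :* y := x :* y :* (con ℤ.1ℤ :* con ℤ.1ℤ)) refl (r n) B ⟩
      r n * B * (1# * 1#)
        ≈⟨ *-congˡ (*-cong (r-inverse k) (r-inverse m)) ⟨
      r n * B * (r k * ((k !) ⋅ 1#) * (r m * ((m !) ⋅ 1#)))
        ≈⟨ solve 6 (λ x c a k b m → x :* c :* (a :* k :* (b :* m)) := x :* (c :* (k :* m)) :* (a :* b)) refl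
             (r n) B (r k) ((k !) ⋅ 1#) (r m) ((m !) ⋅ 1#) ⟩
      r n * (B * (((k !) ⋅ 1#) * ((m !) ⋅ 1#))) * (r k * r m)
        ≈⟨ *-congʳ (*-congˡ (trans (×1-homo-* (n C k) _) (*-congˡ (×1-homo-* (k !) (m !))))) ⟨
      r n * (((n C k) ℕ.* (k ! ℕ.* m !)) ⋅ 1#) * (r k * r m)
        ≈⟨ *-congʳ (*-congˡ (reflexive (≡.cong (_⋅ 1#) (nCk*[k!*[n∸k]!]≡n! k≤n)))) ⟩
      r n * ((n !) ⋅ 1#) * (r k * r m)
        ≈⟨ *-congʳ (r-inverse n) ⟩
      1# * (r k * r m)
        ≈⟨ *-identityˡ _ ⟩
      r k * r m ∎
      where
      m = n ℕ.∸ k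
      B = (n C k) ⋅ 1#

    -- This is the binomial theorem divided by n!.
    conv-term : ∀ x y n → conv (term x) (term y) n ≈ term (x + y) n
    conv-term x y n = begin
      conv (term x) (term y) n
        ≈⟨ conv-sum (term x) (term y) n ⟩
      sum {suc n} (λ k → term x (toℕ k) * term y (n ℕ.∸ toℕ k))
        ≈⟨ sum-cong-≋ {suc n} (λ i → summand (toℕ i) (ℕ.≤-pred (Fin.toℕ<n i))) ⟩
      sum {suc n} (λ k → r n * Binomial.binomialTerm x y n k)
        ≈⟨ *-distribˡ-sum (r n) (Binomial.binomialTerm x y n) ⟨
      r n * Binomial.binomialExpansion x y n
        ≈⟨ *-congˡ (Binomial.theorem n x y) ⟨
      r n * (x + y) ^ n ∎
      where
      summand : ∀ k → k ℕ.≤ n → term x k * term y (n ℕ.∸ k) ≈ r n * ((n C k) ⋅ (x ^ k * y ^ (n ℕ.∸ k)))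
      summand k k≤n = begin
        r k * X * (r m * Y)       ≈⟨ solve 4 (λ a x b y → a :* x :* (b :* y) := a :* b :* (x :* y)) refl (r k) X (r m) Y ⟩
        r k * r m * (X * Y)       ≈⟨ *-congʳ (r-binomial k≤n) ⟨
        r n * (N ⋅ 1#) * (X * Y)  ≈⟨ *-assoc _ _ _ ⟩
        r n * ((N ⋅ 1#) * (X * Y)) ≈⟨ *-congˡ (trans (×-assoc-* N 1# _) (×-congʳ N (*-identityˡ _))) ⟩
        r n * (N ⋅ (X * Y)) ∎
        where
        m = n ℕ.∸ k
        N = n C k
        X = x ^ k
        Y = y ^ m

    ∑term*∑term : ∀ x y n →
      ∑ (term x) n * ∑ (term y) n ≈ ∑ (term (x + y)) n + corner (term x) (term y) n 0
    ∑term*∑term x y n = begin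
      ∑ (term x) n * ∑ (term y) n
        ≡⟨ ≡.cong (λ m → ∑ (term x) n * ∑ (term y) m) (ℕ.+-identityʳ n) ⟨
      ∑ (term x) n * ∑ (term y) (n ℕ.+ 0)
        ≈⟨ ∑*∑-corner (term x) (term y) n 0 ⟩
      triangle (term x) (term y) n + corner (term x) (term y) n 0
        ≈⟨ +-congʳ (trans (triangle≈∑conv _ _ n) (∑-cong n (conv-term x y))) ⟩
      ∑ (term (x + y)) n + corner (term x) (term y) n 0 ∎

-- Order and absolute value on the reals.

module RealLemmas {c ℓ₁ ℓ₂} (R : Reals c ℓ₁ ℓ₂) where
  open Reals R
  module ℝ = CommutativeRingLemmas commutativeRing
  open ℝ.Solver
  module < = IsStrictPartialOrder isStrictPartialOrder
  open Algebra.Apartness.Properties.HeytingCommutativeRing heytingCommutativeRing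
    using (x#0y#0→xy#0; invertibleˡ⇒#; x-0≈x)

  <-cong : ∀ {x x′ y y′} → x ≈ x′ → y ≈ y′ → x < y → x′ < y′
  <-cong x≈x′ y≈y′ x<y = proj₁ <.<-resp-≈ y≈y′ (proj₂ <.<-resp-≈ x≈x′ x<y)

  <-irrefl : ∀ {x} → ¬ (x < x)
  <-irrefl = <.irrefl refl

  <-asym : ∀ {x y} → x < y → ¬ (y < x)
  <-asym x<y y<x = <-irrefl (<.trans x<y y<x)

  -- The substitute for trichotomy. Apartness is cotransitive and each apartness resolves into an
  -- inequality; if that one points the wrong way, transitivity with `x<y` gives the other
  -- alternative.
  <-cotrans : ∀ {x y} → x < y → ∀ z → x < z ⊎ z < y
  <-cotrans x<y z with #-cotrans (<⇒# x<y) z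
  ... | inj₁ x#z with #⇒<⊎> x#z
  ...   | inj₁ x<z = inj₁ x<z
  ...   | inj₂ z<x = inj₂ (<.trans z<x x<y)
  <-cotrans x<y z | inj₂ z#y with #⇒<⊎> z#y
  ...   | inj₁ z<y = inj₂ z<y
  ...   | inj₂ y<z = inj₁ (<.trans x<y y<z)

  <⇒≤ : ∀ {x y} → x < y → x ≤ y
  <⇒≤ = <-asym

  ≤-reflexive : ∀ {x y} → x ≈ y → x ≤ y
  ≤-reflexive x≈y y<x = <.irrefl (sym x≈y) y<x

  ≤-refl : ∀ {x} → x ≤ x
  ≤-refl = <-irrefl

  ≤-<-trans : ∀ {x y z} → x ≤ y → y < z → x < z
  ≤-<-trans {x} x≤y y<z with <-cotrans y<z x
  ... | inj₁ y<x = ⊥-elim (x≤y y<x)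
  ... | inj₂ x<z = x<z

  <-≤-trans : ∀ {x y z} → x < y → y ≤ z → x < z
  <-≤-trans {z = z} x<y y≤z with <-cotrans x<y z
  ... | inj₁ x<z = x<z
  ... | inj₂ z<y = ⊥-elim (y≤z z<y)

  ≤-trans : ∀ {x y z} → x ≤ y → y ≤ z → x ≤ z
  ≤-trans x≤y y≤z z<x = y≤z (<-≤-trans z<x x≤y)

  ≤-cong : ∀ {x x′ y y′} → x ≈ x′ → y ≈ y′ → x ≤ y → x′ ≤ y′
  ≤-cong x≈x′ y≈y′ x≤y = x≤y ∘ <-cong (sym y≈y′) (sym x≈x′)

  ≤-antisym : ∀ {x y} → x ≤ y → y ≤ x → x ≈ y
  ≤-antisym {x} {y} x≤y y≤x = proj₁ (tight x y) λ x#y → case (#⇒<⊎> x#y)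
    where
    case : x < y ⊎ y < x → _
    case (inj₁ x<y) = y≤x x<y
    case (inj₂ y<x) = x≤y y<x

  -- By tightness equality is the negation of apartness, and negations are stable.
  ≈-stable : ∀ {x y} → ¬ ¬ (x ≈ y) → x ≈ y
  ≈-stable ¬¬x≈y = proj₁ (tight _ _) λ x#y → ¬¬x≈y λ x≈y → proj₂ (tight _ _) x≈y x#y

  +-monoʳ-< : ∀ z {x y} → x < y → z + x < z + y
  +-monoʳ-< z x<y = <-cong (+-comm _ _) (+-comm _ _) (+-monoˡ-< z x<y)

  +-monoˡ-≤ : ∀ z {x y} → x ≤ y → x + z ≤ y + z
  +-monoˡ-≤ z x≤y y+z<x+z = x≤y (<-cong (cancel _) (cancel _) (+-monoˡ-< (- z) y+z<x+z))
    where
    cancel : ∀ x → x + z + - z ≈ x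
    cancel x = solve 2 (λ x z → x :+ z :+ :- z := x) refl x z

  +-mono-≤ : ∀ {x y z w} → x ≤ y → z ≤ w → x + z ≤ y + w
  +-mono-≤ {y = y} {z} x≤y z≤w =
    ≤-trans (+-monoˡ-≤ z x≤y) (≤-cong (+-comm _ _) (+-comm _ _) (+-monoˡ-≤ y z≤w))

  +-mono-< : ∀ {x y z w} → x < y → z < w → x + z < y + w
  +-mono-< {y = y} {z} x<y z<w = <.trans (+-monoˡ-< z x<y) (+-monoʳ-< y z<w)

  x<y⇒0<y-x : ∀ {x y} → x < y → 0# < y - x
  x<y⇒0<y-x {x} {y} x<y = <-cong (-‿inverseʳ x) refl (+-monoˡ-< (- x) x<y)

  0<y-x⇒x<y : ∀ {x y} → 0# < y - x → x < y
  0<y-x⇒x<y {x} {y} 0<y-x = <-cong (+-identityˡ x)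
    (solve 2 (λ x y → y :- x :+ x := y) refl x y) (+-monoˡ-< x 0<y-x)

  x≤y⇒0≤y-x : ∀ {x y} → x ≤ y → 0# ≤ y - x
  x≤y⇒0≤y-x {x} {y} x≤y = ≤-cong (-‿inverseʳ x) refl (+-monoˡ-≤ (- x) x≤y)

  0≤y-x⇒x≤y : ∀ {x y} → 0# ≤ y - x → x ≤ y
  0≤y-x⇒x≤y {x} {y} 0≤y-x = ≤-cong (+-identityˡ x)
    (solve 2 (λ x y → y :- x :+ x := y) refl x y) (+-monoˡ-≤ x 0≤y-x)

  neg-mono-< : ∀ {x y} → x < y → - y < - x
  neg-mono-< {x} {y} x<y = 0<y-x⇒x<y
    (<-cong refl (solve 2 (λ x y → y :- x := :- x :- :- y) refl x y) (x<y⇒0<y-x x<y))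

  x<0⇒0<-x : ∀ {x} → x < 0# → 0# < - x
  x<0⇒0<-x x<0 = <-cong (solve 0 (:- con ℤ.0ℤ := con ℤ.0ℤ) refl) refl (neg-mono-< x<0)

  x≤0⇒0≤-x : ∀ {x} → x ≤ 0# → 0# ≤ - x
  x≤0⇒0≤-x x≤0 -x<0 = x≤0 (<-cong refl (solve 1 (λ x → :- :- x := x) refl _) (x<0⇒0<-x -x<0))

  0≤+ : ∀ {x y} → 0# ≤ x → 0# ≤ y → 0# ≤ x + y
  0≤+ 0≤x 0≤y = ≤-cong (+-identityˡ 0#) refl (+-mono-≤ 0≤x 0≤y)

  0<+ : ∀ {x y} → 0# < x → 0# < y → 0# < x + y
  0<+ 0<x 0<y = <-cong (+-identityˡ 0#) refl (+-mono-< 0<x 0<y)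

  -- Suppose the product is negative. Then 0 < x would exclude 0 < y, so y = 0 and the product would
  -- vanish. Hence x = 0, and the product vanishes again.
  0≤* : ∀ {x y} → 0# ≤ x → 0# ≤ y → 0# ≤ x * y
  0≤* {x} {y} 0≤x 0≤y xy<0 = <.irrefl (trans (*-congʳ (sym 0≈x)) (zeroˡ y)) xy<0
    where
    x≤0 : x ≤ 0#
    x≤0 0<x = <.irrefl (trans (*-congˡ (sym (≤-antisym 0≤y λ 0<y → <-asym xy<0 (*-pos 0<x 0<y)))) (zeroʳ x)) xy<0
    0≈x = ≤-antisym 0≤x x≤0

  -- A negative square excludes 0 < x, so `- x` is nonnegative, and it has the same square.
  0≤x*x : ∀ x → 0# ≤ x * x
  0≤x*x x x*x<0 = 0≤* 0≤-x 0≤-x (<-cong (solve 1 (λ x → x :* x := :- x :* :- x) refl x) refl x*x<0)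
    where
    0≤-x : 0# ≤ - x
    0≤-x = x≤0⇒0≤-x λ 0<x → <-asym x*x<0 (*-pos 0<x 0<x)

  *-monoʳ-≤ : ∀ {z x y} → 0# ≤ z → x ≤ y → z * x ≤ z * y
  *-monoʳ-≤ 0≤z x≤y = 0≤y-x⇒x≤y
    (≤-cong refl (solve 3 (λ x y z → z :* (y :- x) := z :* y :- z :* x) refl _ _ _) (0≤* 0≤z (x≤y⇒0≤y-x x≤y)))

  *-mono-≤ : ∀ {x y z w} → 0# ≤ y → 0# ≤ z → x ≤ y → z ≤ w → x * z ≤ y * w
  *-mono-≤ 0≤y 0≤z x≤y z≤w = ≤-trans (≤-cong (*-comm _ _) (*-comm _ _) (*-monoʳ-≤ 0≤z x≤y)) (*-monoʳ-≤ 0≤y z≤w)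

  *-monoʳ-< : ∀ {z x y} → 0# < z → x < y → z * x < z * y
  *-monoʳ-< 0<z x<y = 0<y-x⇒x<y
    (<-cong refl (solve 3 (λ x y z → z :* (y :- x) := z :* y :- z :* x) refl _ _ _) (*-pos 0<z (x<y⇒0<y-x x<y)))

  -- If y is apart from 0, then x cannot be, since a product of elements apart from 0 is apart from
  -- 0. By tightness x would then equal 0, so y is not apart from 0 after all.
  xy≈0⇒y≈0 : ∀ {x y} → x * y ≈ 0# → ¬ (x ≈ 0#) → y ≈ 0#
  xy≈0⇒y≈0 xy≈0 x≉0 = proj₁ (tight _ _) λ y#0 → x≉0 (proj₁ (tight _ _) λ x#0 →
    proj₂ (tight _ _) xy≈0 (x#0y#0→xy#0 x#0 y#0))

  x+y≈0⇒x≈0 : ∀ {x y} → 0# ≤ x → 0# ≤ y → x + y ≈ 0# → x ≈ 0#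
  x+y≈0⇒x≈0 0≤x 0≤y x+y≈0 =
    ≤-antisym (≤-trans (≤-cong (+-identityʳ _) refl (+-mono-≤ ≤-refl 0≤y)) (≤-reflexive x+y≈0)) 0≤x

  x*x≈0⇒x≈0 : ∀ {x} → x * x ≈ 0# → x ≈ 0#
  x*x≈0⇒x≈0 x*x≈0 = ≈-stable λ x≉0 → x≉0 (xy≈0⇒y≈0 x*x≈0 x≉0)

  inverse-pos : ∀ {x y} → 0# < x → y * x ≈ 1# → 0# < y
  inverse-pos {x} {y} 0<x y*x≈1 with #⇒<⊎> (invertibleˡ⇒# (x , trans (*-congˡ (x-0≈x y)) (trans (*-comm x y) y*x≈1)))
  ... | inj₂ 0<y = 0<y
  ... | inj₁ y<0 = ⊥-elim (<-asym 0<1 (<-cong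
    (trans (solve 2 (λ x y → :- (:- y :* x) := y :* x) refl x y) y*x≈1)
    (solve 0 (:- con ℤ.0ℤ := con ℤ.0ℤ) refl) (neg-mono-< (*-pos (x<0⇒0<-x y<0) 0<x))))

  reciprocal : ∀ {x} → 0# < x → ∃[ y ] (0# < y × x * y ≈ 1#)
  -- The field axiom inverts the difference `x - 0#`, hence the corrections by `x-0≈x`.
  reciprocal {x} 0<x with #⇒invertible (#-sym (<⇒# 0<x))
  ... | y , yx≈1 , xy≈1 = y , inverse-pos 0<x (trans (*-congˡ (sym (x-0≈x x))) yx≈1)
                            , trans (*-congʳ (sym (x-0≈x x))) xy≈1

  1/fromℕ*fromℕ : ∀ n .{{_ : ℕ.NonZero n}} → 1/fromℕ n * fromℕ n ≈ 1#
  1/fromℕ*fromℕ n = trans (*-congˡ (sym (x-0≈x (fromℕ n))))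
    (proj₁ (proj₂ (#⇒invertible (#-sym (<⇒# (0<fromℕ n))))))

  0<1/fromℕ : ∀ n .{{_ : ℕ.NonZero n}} → 0# < 1/fromℕ n
  0<1/fromℕ n = inverse-pos (0<fromℕ n) (1/fromℕ*fromℕ n)

  0≤fromℕ : ∀ n → 0# ≤ fromℕ n
  0≤fromℕ zero    = ≤-refl
  0≤fromℕ (suc n) = <⇒≤ (0<fromℕ (suc n))

  fromℕ-mono-≤ : ∀ {m n} → m ℕ.≤ n → fromℕ m ≤ fromℕ n
  fromℕ-mono-≤ {n = n} ℕ.z≤n = 0≤fromℕ n
  fromℕ-mono-≤ (ℕ.s≤s m≤n) = +-mono-≤ ≤-refl (fromℕ-mono-≤ m≤n)

  fromℕ-mono-< : ∀ {m n} → m ℕ.< n → fromℕ m < fromℕ n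
  fromℕ-mono-< {m} {n} m<n = <-≤-trans (<-cong (+-identityˡ _) refl (+-monoˡ-< (fromℕ m) 0<1)) (fromℕ-mono-≤ m<n)

  2ℝ : ℝ
  2ℝ = 1# + 1#

  fromℕ-2 : fromℕ 2 ≈ 2ℝ
  fromℕ-2 = +-congˡ (+-identityʳ 1#)

  0<2 : 0# < 2ℝ
  0<2 = 0<+ 0<1 0<1

  half : ℝ → ℝ
  half x = 1/fromℕ 2 * x

  half+half : ∀ x → half x + half x ≈ x
  half+half x = trans (solve 2 (λ h x → h :* x :+ h :* x := h :* (con ℤ.1ℤ :+ con ℤ.1ℤ) :* x) refl (1/fromℕ 2) x)
    (trans (*-congʳ (trans (*-congˡ (sym fromℕ-2)) (1/fromℕ*fromℕ 2))) (*-identityˡ x))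

  0<half : ∀ {x} → 0# < x → 0# < half x
  0<half = *-pos (0<1/fromℕ 2)

  half<x : ∀ {x} → 0# < x → half x < x
  half<x {x} 0<x = <-cong (+-identityˡ _) (half+half x) (+-monoˡ-< (half x) (0<half 0<x))

  x≤∣x∣ : ∀ x → x ≤ ∣ x ∣
  x≤∣x∣ x = proj₁ (∨-sup x (- x))

  -x≤∣x∣ : ∀ x → - x ≤ ∣ x ∣
  -x≤∣x∣ x = proj₁ (proj₂ (∨-sup x (- x)))

  0≤∣x∣ : ∀ x → 0# ≤ ∣ x ∣
  0≤∣x∣ x ∣x∣<0 = <-asym (≤-<-trans (x≤∣x∣ x) ∣x∣<0)
    (<-cong refl (solve 1 (λ x → :- :- x := x) refl x) (x<0⇒0<-x (≤-<-trans (-x≤∣x∣ x) ∣x∣<0)))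

  -- Expresses that the absolute value is at most b without using the join, so that estimates become
  -- pure order and ring algebra.
  Bounded : ℝ → ℝ → Set ℓ₂
  Bounded x b = x ≤ b × - x ≤ b

  bounded-∣x∣ : ∀ x → Bounded x ∣ x ∣
  bounded-∣x∣ x = x≤∣x∣ x , -x≤∣x∣ x

  bounded-≤ : ∀ {x a b} → a ≤ b → Bounded x a → Bounded x b
  bounded-≤ a≤b (p , q) = ≤-trans p a≤b , ≤-trans q a≤b

  bounded-cong : ∀ {x y b} → x ≈ y → Bounded x b → Bounded y b
  bounded-cong x≈y (p , q) = ≤-cong x≈y refl p , ≤-cong (-‿cong x≈y) refl q

  bounded-nonneg : ∀ {x b} → 0# ≤ x → x ≤ b → Bounded x b
  bounded-nonneg {x} 0≤x x≤b = x≤b , ≤-trans (≤-trans -x≤0 0≤x) x≤b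
    where
    -x≤0 : - x ≤ 0#
    -x≤0 = 0≤y-x⇒x≤y (≤-cong refl (solve 1 (λ x → x := con ℤ.0ℤ :- :- x) refl x) 0≤x)

  bounded-neg : ∀ {x b} → Bounded x b → Bounded (- x) b
  bounded-neg {x} (p , q) = q , ≤-cong (solve 1 (λ x → x := :- :- x) refl x) refl p

  bounded-+ : ∀ {x y a b} → Bounded x a → Bounded y b → Bounded (x + y) (a + b)
  bounded-+ {x} {y} (p , q) (p′ , q′) = +-mono-≤ p p′ ,
    ≤-cong (solve 2 (λ x y → :- x :+ :- y := :- (x :+ y)) refl x y) refl (+-mono-≤ q q′)

  bounded-* : ∀ {x y a b} → Bounded x a → Bounded y b → Bounded (x * y) (a * b)
  bounded-* {x} {y} {a} {b} bx by = upper bx by ,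
    ≤-cong (solve 2 (λ x y → :- x :* y := :- (x :* y)) refl x y) refl (upper (bounded-neg bx) by)
    where
    -- (a - x)(b + y) + (a + x)(b - y) = 2(ab - xy)
    upper : ∀ {x y} → Bounded x a → Bounded y b → x * y ≤ a * b
    upper {x} {y} (x≤a , -x≤a) (y≤b , -y≤b) ab<xy =
      0≤+ (0≤* (x≤y⇒0≤y-x x≤a) (x≤y⇒0≤y-x -y≤b)) (0≤* (x≤y⇒0≤y-x -x≤a) (x≤y⇒0≤y-x y≤b))
        (0<y-x⇒x<y (<-cong refl (solve 4 (λ a b x y → x :* y :- a :* b :+ (x :* y :- a :* b)
            := con ℤ.0ℤ :- ((a :- x) :* (b :- :- y) :+ (a :- :- x) :* (b :- y))) refl a b x y)
          (0<+ (x<y⇒0<y-x ab<xy) (x<y⇒0<y-x ab<xy))))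

-- Null sequences and limits.

module Limits {c ℓ₁ ℓ₂} (R : Reals c ℓ₁ ℓ₂) where
  open Reals R
  open RealLemmas R
  open ℝ.Solver

  Null : (ℕ → ℝ) → Set _
  Null s = ∀ ε → 0# < ε → ∃[ N ] (∀ n → N ℕ.≤ n → Bounded (s n) ε)

  Limit : (ℕ → ℝ) → ℝ → Set _
  Limit s x = Null (λ n → s n - x)

  converges⇒limit : ∀ {s x} → Converges s x → Limit s x
  converges⇒limit s→x ε 0<ε with s→x ε 0<ε
  ... | N , close = N , λ n N≤n → bounded-≤ (<⇒≤ (close n N≤n)) (bounded-∣x∣ _)

  null-cong : ∀ {s t} → (∀ n → s n ≈ t n) → Null s → Null t
  null-cong s≈t s→0 ε 0<ε with s→0 ε 0<ε
  ... | N , small = N , λ n N≤n → bounded-cong (s≈t n) (small n N≤n)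

  null-dominated : ∀ {s t} → (∀ n → Bounded (s n) (t n)) → Null t → Null s
  null-dominated s≼t t→0 ε 0<ε with t→0 ε 0<ε
  ... | N , small = N , λ n N≤n → bounded-≤ (proj₁ (small n N≤n)) (s≼t n)

  null-neg : ∀ {s} → Null s → Null (λ n → - s n)
  null-neg s→0 ε 0<ε with s→0 ε 0<ε
  ... | N , small = N , λ n N≤n → bounded-neg (small n N≤n)

  null-+ : ∀ {s t} → Null s → Null t → Null (λ n → s n + t n)
  null-+ s→0 t→0 ε 0<ε with s→0 (half ε) (0<half 0<ε) | t→0 (half ε) (0<half 0<ε)
  ... | M , small-s | N , small-t = M ℕ.⊔ N , λ n M⊔N≤n → bounded-≤ (≤-reflexive (half+half ε))
    (bounded-+ (small-s n (ℕ.m⊔n≤o⇒m≤o M N M⊔N≤n)) (small-t n (ℕ.m⊔n≤o⇒n≤o M N M⊔N≤n)))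

  null-bounded* : ∀ {s t : ℕ → ℝ} {b} → 0# < b → ∃[ N ] (∀ n → N ℕ.≤ n → Bounded (s n) b) → Null t →
                  Null (λ n → s n * t n)
  null-bounded* {b = b} 0<b (M , bound) t→0 ε 0<ε with reciprocal 0<b
  ... | b⁻¹ , 0<b⁻¹ , b*b⁻¹≈1 with t→0 (b⁻¹ * ε) (*-pos 0<b⁻¹ 0<ε)
  ...   | N , small = M ℕ.⊔ N , λ n M⊔N≤n →
    bounded-≤ (≤-reflexive (trans (sym (*-assoc b b⁻¹ ε)) (trans (*-congʳ b*b⁻¹≈1) (*-identityˡ ε))))
      (bounded-* (bound n (ℕ.m⊔n≤o⇒m≤o M N M⊔N≤n)) (small n (ℕ.m⊔n≤o⇒n≤o M N M⊔N≤n)))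

  null-scale : ∀ x {s} → Null s → Null (λ n → x * s n)
  -- The bound is the absolute value of x plus 1, because `null-bounded*` divides by its bound and
  -- so needs it strictly positive.
  null-scale x = null-bounded* {s = λ _ → x} (<-≤-trans 0<1 (≤-cong (+-identityˡ 1#) refl (+-monoˡ-≤ 1# (0≤∣x∣ x))))
    (0 , λ _ _ → bounded-≤ (≤-cong (+-identityʳ _) refl (+-mono-≤ ≤-refl (<⇒≤ 0<1))) (bounded-∣x∣ x))

  null-* : ∀ {s t} → Null s → Null t → Null (λ n → s n * t n)
  null-* {s} s→0 = null-bounded* {s = s} 0<1 (s→0 1# 0<1)

  null-subsequence : ∀ {s} (f : ℕ → ℕ) → (∀ n → n ℕ.≤ f n) → Null s → Null (s ∘ f)
  null-subsequence f n≤f s→0 ε 0<ε with s→0 ε 0<ε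
  ... | N , small = N , λ n N≤n → small (f n) (ℕ.≤-trans N≤n (n≤f n))

  null-constant : ∀ {x} → Null (λ _ → x) → x ≈ 0#
  null-constant {x} x→0 = ≤-antisym (nonpos (λ ε 0<ε → proj₁ (at ε 0<ε)))
    (λ x<0 → nonpos (λ ε 0<ε → proj₂ (at ε 0<ε)) (x<0⇒0<-x x<0))
    where
    at : ∀ ε → 0# < ε → Bounded x ε
    at ε 0<ε with x→0 ε 0<ε
    ... | N , small = small N ℕ.≤-refl
    nonpos : ∀ {y} → (∀ ε → 0# < ε → y ≤ ε) → y ≤ 0#
    nonpos y≤ε 0<y = y≤ε _ (0<half 0<y) (half<x 0<y)

  limit-unique : ∀ {s x y} → Limit s x → Limit s y → x ≈ y
  limit-unique {s} {x} {y} s→x s→y =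
    trans (solve 2 (λ x y → x := (x :- y) :+ y) refl x y) (trans (+-congʳ x-y≈0) (+-identityˡ y))
    where
    x-y≈0 : x - y ≈ 0#
    x-y≈0 = null-constant (null-cong
      (λ n → solve 3 (λ s x y → (s :- y) :+ :- (s :- x) := x :- y) refl (s n) x y) (null-+ s→y (null-neg s→x)))

  limit-+ : ∀ {s t x y} → Limit s x → Limit t y → Limit (λ n → s n + t n) (x + y)
  limit-+ {s} {t} {x} {y} s→x t→y = null-cong
    (λ n → solve 4 (λ s t x y → (s :- x) :+ (t :- y) := s :+ t :- (x :+ y)) refl (s n) (t n) x y) (null-+ s→x t→y)

  limit-neg : ∀ {s x} → Limit s x → Limit (λ n → - s n) (- x)
  limit-neg {s} {x} s→x = null-cong (λ n → solve 2 (λ s x → :- (s :- x) := :- s :- :- x) refl (s n) x) (null-neg s→x)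

  limit-* : ∀ {s t x y} → Limit s x → Limit t y → Limit (λ n → s n * t n) (x * y)
  limit-* {s} {t} {x} {y} s→x t→y = null-cong
    (λ n → solve 4 (λ s t x y → (s :- x) :* (t :- y) :+ (x :* (t :- y) :+ y :* (s :- x)) := s :* t :- x :* y) refl (s n) (t n) x y)
    (null-+ (null-* s→x t→y) (null-+ (null-scale x t→y) (null-scale y s→x)))

  limit-cong : ∀ {s t x} → (∀ n → s n ≈ t n) → Limit s x → Limit t x
  limit-cong s≈t = null-cong (λ n → +-congʳ (s≈t n))

  limit-≥ : ∀ {s x b} → (∀ n → b ≤ s n) → Limit s x → b ≤ x
  limit-≥ {s} {x} {b} b≤s s→x x<b with s→x (half (b - x)) (0<half (x<y⇒0<y-x x<b))
  ... | N , small = ≤-trans (+-monoˡ-≤ (- x) (b≤s N)) (proj₁ (small N ℕ.≤-refl)) (half<x (x<y⇒0<y-x x<b))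

-- The complex numbers: ring structure, limits and bounds.

module Complex {c ℓ₁ ℓ₂} (R : Reals c ℓ₁ ℓ₂) where
  open Reals R
  open Analysis R
  open RealLemmas R
  open Limits R
  open ℝ.Solver
  open RawRing complexRing public using () renaming (_+_ to _+ᶜ_; -_ to -ᶜ_)

  complexCommutativeRing : CommutativeRing c ℓ₁
  complexCommutativeRing = record
    { Carrier = ℂ ; _≈_ = _≈ᶜ_ ; _+_ = _+ᶜ_ ; _*_ = _*ᶜ_ ; -_ = -ᶜ_ ; 0# = 0ᶜ ; 1# = 1ᶜ
    ; isCommutativeRing = record
      { isRing = record
        { +-isAbelianGroup = record
          { isGroup = record
            { isMonoid = record
              { isSemigroup = record
                { isMagma = record
                  { isEquivalence = record
                    { refl  = refl , refl
                    ; sym   = λ (p , q) → sym p , sym q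
                    ; trans = λ (p , q) (p′ , q′) → trans p p′ , trans q q′
                    }
                  ; ∙-cong = λ (p , q) (p′ , q′) → +-cong p p′ , +-cong q q′
                  }
                ; assoc = λ _ _ _ → +-assoc _ _ _ , +-assoc _ _ _
                }
              ; identity = (λ _ → +-identityˡ _ , +-identityˡ _) , (λ _ → +-identityʳ _ , +-identityʳ _)
              }
            ; inverse = (λ _ → -‿inverseˡ _ , -‿inverseˡ _) , (λ _ → -‿inverseʳ _ , -‿inverseʳ _)
            ; ⁻¹-cong = λ (p , q) → -‿cong p , -‿cong q
            }
          ; comm = λ _ _ → +-comm _ _ , +-comm _ _
          }
        ; *-cong = λ (p , q) (p′ , q′) →
            +-cong (*-cong p p′) (-‿cong (*-cong q q′)) , +-cong (*-cong p q′) (*-cong q p′)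
        ; *-assoc = λ (a +i b) (c +i d) (e +i f) →
            solve 6 (λ a b c d e f → (a :* c :- b :* d) :* e :- (a :* d :+ b :* c) :* f
                                  := a :* (c :* e :- d :* f) :- b :* (c :* f :+ d :* e)) refl a b c d e f ,
            solve 6 (λ a b c d e f → (a :* c :- b :* d) :* f :+ (a :* d :+ b :* c) :* e
                                  := a :* (c :* f :+ d :* e) :+ b :* (c :* e :- d :* f)) refl a b c d e f
        ; *-identity =
            (λ (a +i b) → solve 2 (λ a b → con ℤ.1ℤ :* a :- con ℤ.0ℤ :* b := a) refl a b ,
                          solve 2 (λ a b → con ℤ.1ℤ :* b :+ con ℤ.0ℤ :* a := b) refl a b) ,
            (λ (a +i b) → solve 2 (λ a b → a :* con ℤ.1ℤ :- b :* con ℤ.0ℤ := a) refl a b ,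
                          solve 2 (λ a b → a :* con ℤ.0ℤ :+ b :* con ℤ.1ℤ := b) refl a b)
        ; distrib =
            (λ (a +i b) (c +i d) (e +i f) →
              solve 6 (λ a b c d e f → a :* (c :+ e) :- b :* (d :+ f)
                                    := (a :* c :- b :* d) :+ (a :* e :- b :* f)) refl a b c d e f ,
              solve 6 (λ a b c d e f → a :* (d :+ f) :+ b :* (c :+ e)
                                    := (a :* d :+ b :* c) :+ (a :* f :+ b :* e)) refl a b c d e f) ,
            (λ (a +i b) (c +i d) (e +i f) →
              solve 6 (λ a b c d e f → (c :+ e) :* a :- (d :+ f) :* b
                                    := (c :* a :- d :* b) :+ (e :* a :- f :* b)) refl a b c d e f ,
              solve 6 (λ a b c d e f → (c :+ e) :* b :+ (d :+ f) :* a
                                    := (c :* b :+ d :* a) :+ (e :* b :+ f :* a)) refl a b c d e f)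
        }
      ; *-comm = λ (a +i b) (c +i d) →
          solve 4 (λ a b c d → a :* c :- b :* d := c :* a :- d :* b) refl a b c d ,
          solve 4 (λ a b c d → a :* d :+ b :* c := c :* b :+ d :* a) refl a b c d
      }
    }

  module ℂ-Ring = CommutativeRing complexCommutativeRing
  module ℂ-Lemmas = CommutativeRingLemmas complexCommutativeRing

  fromℝ-cong : ∀ {x y} → x ≈ y → fromℝ x ≈ᶜ fromℝ y
  fromℝ-cong x≈y = x≈y , refl

  fromℝ-+ : ∀ x y → fromℝ (x + y) ≈ᶜ fromℝ x +ᶜ fromℝ y
  fromℝ-+ x y = refl , sym (+-identityˡ 0#)

  fromℝ-* : ∀ x y → fromℝ (x * y) ≈ᶜ fromℝ x *ᶜ fromℝ y
  fromℝ-* x y = solve 2 (λ x y → x :* y := x :* y :- con ℤ.0ℤ :* con ℤ.0ℤ) refl x y ,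
                solve 2 (λ x y → con ℤ.0ℤ := x :* con ℤ.0ℤ :+ con ℤ.0ℤ :* y) refl x y

  fromℝ-fromℕ : ∀ n → fromℝ (fromℕ n) ≈ᶜ n ℂ-Lemmas.⋅ 1ᶜ
  fromℝ-fromℕ zero    = ℂ-Ring.refl
  fromℝ-fromℕ (suc n) = ℂ-Ring.trans (fromℝ-+ 1# (fromℕ n)) (ℂ-Ring.+-congˡ (fromℝ-fromℕ n))

  fromℝ-^ : ∀ x n → fromℝ (x ℝ.^ n) ≈ᶜ fromℝ x ^ᶜ n
  fromℝ-^ x zero    = ℂ-Ring.refl
  fromℝ-^ x (suc n) = ℂ-Ring.trans (fromℝ-* x _) (ℂ-Ring.*-congˡ (fromℝ-^ x n))

  Limitᶜ : (ℕ → ℂ) → ℂ → Set _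
  Limitᶜ s z = Limit (re ∘ s) (re z) × Limit (im ∘ s) (im z)

  limitᶜ-unique : ∀ {s z w} → Limitᶜ s z → Limitᶜ s w → z ≈ᶜ w
  limitᶜ-unique (p , q) (p′ , q′) = limit-unique p p′ , limit-unique q q′

  limitᶜ-cong : ∀ {s t z} → (∀ n → s n ≈ᶜ t n) → Limitᶜ s z → Limitᶜ t z
  limitᶜ-cong s≈t (p , q) = limit-cong (proj₁ ∘ s≈t) p , limit-cong (proj₂ ∘ s≈t) q

  limitᶜ-* : ∀ {s t z w} → Limitᶜ s z → Limitᶜ t w → Limitᶜ (λ n → s n *ᶜ t n) (z *ᶜ w)
  limitᶜ-* (p , q) (p′ , q′) =
    limit-+ (limit-* p p′) (limit-neg (limit-* q q′)) , limit-+ (limit-* p q′) (limit-* q p′)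

  infix 4 _≼_
  -- Bounding both parts replaces the modulus, which would require square roots. The price is the
  -- factor 2 in `≼-*`.
  _≼_ : ℂ → ℝ → Set _
  z ≼ b = Bounded (re z) b × Bounded (im z) b

  ≼-cong : ∀ {z a b} → a ≈ b → z ≼ a → z ≼ b
  ≼-cong a≈b (p , q) = bounded-≤ (≤-reflexive a≈b) p , bounded-≤ (≤-reflexive a≈b) q

  ≼-+ : ∀ {z w a b} → z ≼ a → w ≼ b → z +ᶜ w ≼ a + b
  ≼-+ (p , q) (p′ , q′) = bounded-+ p p′ , bounded-+ q q′

  ≼-* : ∀ {z w a b} → z ≼ a → w ≼ b → z *ᶜ w ≼ 2ℝ * (a * b)
  ≼-* {a = a} {b} (p , q) (p′ , q′) = ≼-cong
    (solve 1 (λ x → x :+ x := (con ℤ.1ℤ :+ con ℤ.1ℤ) :* x) refl (a * b))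
    (bounded-+ (bounded-* p p′) (bounded-neg (bounded-* q q′)) , bounded-+ (bounded-* p q′) (bounded-* q p′))

  ≼-0 : 0ᶜ ≼ 0#
  ≼-0 = bounded-nonneg ≤-refl ≤-refl , bounded-nonneg ≤-refl ≤-refl

  ≼-∑ : ∀ {u x} n → (∀ k → u k ≼ x k) → ℂ-Lemmas.∑ u n ≼ ℝ.∑ x n
  ≼-∑ zero    u≼x = ≼-0
  ≼-∑ (suc n) u≼x = ≼-+ (u≼x 0) (≼-∑ n (u≼x ∘ suc))

  -- Each row of the corner is a single product, so it pays the factor 2 of `≼-*` once, and this
  -- factor can be taken out of the sum of the rows.
  ≼-corner : ∀ {u v x y} n d → (∀ k → u k ≼ x k) → (∀ k → v k ≼ y k) →
             ℂ-Lemmas.corner u v n d ≼ 2ℝ * ℝ.corner x y n d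
  ≼-corner zero    d u≼x v≼y = ≼-cong (sym (zeroʳ 2ℝ)) ≼-0
  ≼-corner (suc n) d u≼x v≼y = ≼-cong (sym (distribˡ 2ℝ _ _))
    (≼-+ (≼-* (u≼x 0) (≼-∑ d (v≼y ∘ (suc n ℕ.+_)))) (≼-corner n (suc d) (u≼x ∘ suc) v≼y))

-- The exponential series and its functional equation.

module ExponentialSeries {c ℓ₁ ℓ₂} (R : Reals c ℓ₁ ℓ₂) where
  open Reals R
  open Analysis R
  open RealLemmas R
  open Limits R
  open Complex R
  open ℝ.Solver
  open ℝ using (∑; triangle; corner)

  ∑-nonneg : ∀ {u} n → (∀ k → 0# ≤ u k) → 0# ≤ ∑ u n
  ∑-nonneg zero    0≤u = ≤-refl
  ∑-nonneg (suc n) 0≤u = 0≤+ (0≤u 0) (∑-nonneg n (0≤u ∘ suc))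

  ∑-mono-length : ∀ {u m n} → m ℕ.≤ n → (∀ k → 0# ≤ u k) → ∑ u m ≤ ∑ u n
  ∑-mono-length {n = n} ℕ.z≤n       0≤u = ∑-nonneg n 0≤u
  ∑-mono-length         (ℕ.s≤s m≤n) 0≤u = +-mono-≤ ≤-refl (∑-mono-length m≤n (0≤u ∘ suc))

  triangle-nonneg : ∀ {u v} n → (∀ k → 0# ≤ u k) → (∀ k → 0# ≤ v k) → 0# ≤ triangle u v n
  triangle-nonneg zero    0≤u 0≤v = ≤-refl
  triangle-nonneg (suc n) 0≤u 0≤v =
    0≤+ (0≤* (0≤u 0) (∑-nonneg (suc n) 0≤v)) (triangle-nonneg n (0≤u ∘ suc) 0≤v)

  corner-nonneg : ∀ {u v} n d → (∀ k → 0# ≤ u k) → (∀ k → 0# ≤ v k) → 0# ≤ corner u v n d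
  corner-nonneg zero    d 0≤u 0≤v = ≤-refl
  corner-nonneg (suc n) d 0≤u 0≤v =
    0≤+ (0≤* (0≤u 0) (∑-nonneg d (0≤v ∘ (suc n ℕ.+_)))) (corner-nonneg n (suc d) (0≤u ∘ suc) 0≤v)

  -- From j < m and k < n follows j + k < m + n, so the rectangle lies inside the triangle and the
  -- terms left over are nonnegative.
  ∑*∑≤triangle : ∀ {u v} m n → (∀ k → 0# ≤ u k) → (∀ k → 0# ≤ v k) →
                 ∑ u m * ∑ v n ≤ triangle u v (m ℕ.+ n)
  ∑*∑≤triangle zero    n 0≤u 0≤v = ≤-cong (sym (zeroˡ _)) refl (triangle-nonneg n 0≤u 0≤v)
  ∑*∑≤triangle (suc m) n 0≤u 0≤v = ≤-cong (sym (distribʳ _ _ _)) refl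
    (+-mono-≤ (*-monoʳ-≤ (0≤u 0) (∑-mono-length (ℕ.m≤n+m n (suc m)) 0≤v))
              (∑*∑≤triangle m n (0≤u ∘ suc) 0≤v))

  fact⁻¹ : ℕ → ℝ
  fact⁻¹ k = 1/fromℕ (k !) {{k ℕ.!≢0}}

  fact⁻¹-inverse : ∀ k → fact⁻¹ k * fromℕ (k !) ≈ 1#
  fact⁻¹-inverse k = 1/fromℕ*fromℕ (k !) {{k ℕ.!≢0}}

  0≤fact⁻¹ : ∀ k → 0# ≤ fact⁻¹ k
  0≤fact⁻¹ k = <⇒≤ (0<1/fromℕ (k !) {{k ℕ.!≢0}})

  fact⁻¹-suc : ∀ k → fact⁻¹ k ≈ fromℕ (suc k) * fact⁻¹ (suc k)
  fact⁻¹-suc k = begin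
    r                    ≈⟨ *-identityʳ r ⟨
    r * 1#               ≈⟨ *-congˡ (fact⁻¹-inverse (suc k)) ⟨
    r * (r′ * fromℕ (suc k !)) ≈⟨ *-congˡ (*-congˡ (ℝ.×1-homo-* (suc k) (k !))) ⟩
    r * (r′ * (n * f))   ≈⟨ solve 4 (λ r r′ n f → r :* (r′ :* (n :* f)) := (r :* f) :* (n :* r′)) refl r r′ n f ⟩
    (r * f) * (n * r′)   ≈⟨ *-congʳ (fact⁻¹-inverse k) ⟩
    1# * (n * r′)        ≈⟨ *-identityˡ _ ⟩
    n * r′               ∎
    where
    open Relation.Binary.Reasoning.Setoid (CommutativeRing.setoid commutativeRing)
    r = fact⁻¹ k
    r′ = fact⁻¹ (suc k)
    n = fromℕ (suc k)
    f = fromℕ (k !)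

  fact⁻¹ᶜ-inverse : ∀ k → fromℝ (fact⁻¹ k) *ᶜ ((k !) ℂ-Lemmas.⋅ 1ᶜ) ≈ᶜ 1ᶜ
  fact⁻¹ᶜ-inverse k = ℂ-Ring.trans (ℂ-Ring.*-congˡ {fromℝ (fact⁻¹ k)} (ℂ-Ring.sym (fromℝ-fromℕ (k !))))
    (ℂ-Ring.trans (ℂ-Ring.sym (fromℝ-* (fact⁻¹ k) (fromℕ (k !)))) (fromℝ-cong (fact⁻¹-inverse k)))

  open ℝ.ExponentialTerms fact⁻¹ fact⁻¹-inverse using (term; conv-term; ∑term*∑term)
  module Termᶜ = ℂ-Lemmas.ExponentialTerms (fromℝ ∘ fact⁻¹) fact⁻¹ᶜ-inverse
  open Termᶜ using () renaming (term to termᶜ)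
  open ℂ-Lemmas using () renaming (∑ to ∑ᶜ; corner to cornerᶜ)

  ^-nonneg : ∀ {x} k → 0# ≤ x → 0# ≤ x ℝ.^ k
  ^-nonneg zero    0≤x = <⇒≤ 0<1
  ^-nonneg (suc k) 0≤x = 0≤* 0≤x (^-nonneg k 0≤x)

  term-nonneg : ∀ {x} → 0# ≤ x → ∀ k → 0# ≤ term x k
  term-nonneg 0≤x k = 0≤* (0≤fact⁻¹ k) (^-nonneg k 0≤x)

  -- The n by n square consists of the triangle of size n and the corner, and it lies inside the
  -- triangle of size 2n. By `conv-term` both triangles are partial sums of the series at x + y.
  corner-term-≤ : ∀ {x y} → 0# ≤ x → 0# ≤ y → ∀ n →
    corner (term x) (term y) n 0 ≤ ∑ (term (x + y)) (n ℕ.+ n) - ∑ (term (x + y)) n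
  corner-term-≤ {x} {y} 0≤x 0≤y n = ≤-cong
    (trans (+-congʳ (∑term*∑term x y n)) (solve 2 (λ e k → e :+ k :- e := k) refl (∑ (term (x + y)) n) _))
    (+-congʳ (trans (ℝ.triangle≈∑conv (term x) (term y) (n ℕ.+ n)) (ℝ.∑-cong (n ℕ.+ n) (conv-term x y))))
    (+-monoˡ-≤ (- ∑ (term (x + y)) n) (∑*∑≤triangle n n (term-nonneg 0≤x) (term-nonneg 0≤y)))

  null-corner : ∀ {x y e} → 0# ≤ x → 0# ≤ y → Limit (∑ (term (x + y))) e →
                Null (λ n → corner (term x) (term y) n 0)
  null-corner {x} {y} {e} 0≤x 0≤y E→e = null-dominated
    (λ n → bounded-nonneg (corner-nonneg n 0 (term-nonneg 0≤x) (term-nonneg 0≤y)) (corner-term-≤ 0≤x 0≤y n))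
    (null-cong (λ n → solve 3 (λ a b e → a :- e :+ :- (b :- e) := a :- b) refl (E (n ℕ.+ n)) (E n) e)
      (null-+ (null-subsequence (λ n → n ℕ.+ n) (λ n → ℕ.m≤m+n n n) E→e) (null-neg E→e)))
    where E = ∑ (term (x + y))

  termᶜ-fromℝ : ∀ x k → termᶜ (fromℝ x) k ≈ᶜ fromℝ (term x k)
  termᶜ-fromℝ x k = ℂ-Ring.trans (ℂ-Ring.*-congˡ {fromℝ (fact⁻¹ k)} (ℂ-Ring.sym (fromℝ-^ x k)))
    (ℂ-Ring.sym (fromℝ-* (fact⁻¹ k) _))

  re-∑ : ∀ u n → re (∑ᶜ u n) ≈ ∑ (re ∘ u) n
  re-∑ u zero    = refl
  re-∑ u (suc n) = +-congˡ (re-∑ (u ∘ suc) n)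

  -- The factor 2 of each multiplication is absorbed into the base, so that the dominating series is
  -- again an exponential series, namely the one at 2b.
  ≼-^ : ∀ {z b} → z ≼ b → ∀ k → z ^ᶜ k ≼ (2ℝ * b) ℝ.^ k
  ≼-^ z≼b zero    = bounded-nonneg (<⇒≤ 0<1) ≤-refl , bounded-nonneg ≤-refl (<⇒≤ 0<1)
  ≼-^ {b = b} z≼b (suc k) = ≼-cong (sym (*-assoc 2ℝ b _)) (≼-* z≼b (≼-^ z≼b k))

  fromℝ*-≼ : ∀ {x z b} → 0# ≤ x → z ≼ b → fromℝ x *ᶜ z ≼ x * b
  fromℝ*-≼ {x} {p +i q} {b} 0≤x (bp , bq) =
    bounded-cong (solve 3 (λ x p q → x :* p := x :* p :- con ℤ.0ℤ :* q) refl x p q) (bounded-* (bounded-nonneg 0≤x ≤-refl) bp) ,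
    bounded-cong (solve 3 (λ x p q → x :* q := x :* q :+ con ℤ.0ℤ :* p) refl x p q) (bounded-* (bounded-nonneg 0≤x ≤-refl) bq)

  termᶜ-≼ : ∀ {z b} → z ≼ b → ∀ k → termᶜ z k ≼ term (2ℝ * b) k
  termᶜ-≼ z≼b k = fromℝ*-≼ (0≤fact⁻¹ k) (≼-^ z≼b k)

  ≼-exists : ∀ z → ∃[ b ] (0# ≤ b × z ≼ b)
  ≼-exists (p +i q) = ∣ p ∣ + ∣ q ∣ , 0≤+ (0≤∣x∣ p) (0≤∣x∣ q) ,
    bounded-≤ (≤-cong (+-identityʳ _) refl (+-mono-≤ ≤-refl (0≤∣x∣ q))) (bounded-∣x∣ p) ,
    bounded-≤ (≤-cong (+-identityˡ _) refl (+-mono-≤ (0≤∣x∣ p) ≤-refl)) (bounded-∣x∣ q)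

  module Exponential (exp : ℂ → ℂ) (isExp : IsExponential exp) where

    exp-limit : ∀ z → Limitᶜ (∑ᶜ (termᶜ z)) (exp z)
    exp-limit z = converges⇒limit (proj₁ (isExp z)) , converges⇒limit (proj₂ (isExp z))

    -- Convergence of the dominating real series is obtained by reading the assumption on `exp` at a
    -- real argument.
    exp-real-limit : ∀ x → Limit (∑ (term x)) (re (exp (fromℝ x)))
    exp-real-limit x = limit-cong
      (λ n → trans (re-∑ (termᶜ (fromℝ x)) n) (ℝ.∑-cong n (λ k → proj₁ (termᶜ-fromℝ x k))))
      (proj₁ (exp-limit (fromℝ x)))

    -- Nothing in the type of `exp` makes it respect `_≈ᶜ_`. It does so because its values are
    -- limits of series with equal terms, and limits are unique.
    exp-cong : ∀ {z w} → z ≈ᶜ w → exp z ≈ᶜ exp w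
    exp-cong {z} {w} z≈w = limitᶜ-unique
      (limitᶜ-cong (λ n → ℂ-Lemmas.∑-cong n
        (λ k → ℂ-Ring.*-congˡ {fromℝ (fact⁻¹ k)} (ℂ-Lemmas.^-congˡ k z≈w))) (exp-limit z))
      (exp-limit w)

    exp-+ : ∀ z w → exp (z +ᶜ w) ≈ᶜ exp z *ᶜ exp w
    exp-+ z w = limitᶜ-unique {λ n → Ez n *ᶜ Ew n} sums→exp
      (limitᶜ-* {Ez} {Ew} (exp-limit z) (exp-limit w))
      where
      a b : ℝ
      a = proj₁ (≼-exists z)
      b = proj₁ (≼-exists w)

      z≼a : z ≼ a
      z≼a = proj₂ (proj₂ (≼-exists z))

      w≼b : w ≼ b
      w≼b = proj₂ (proj₂ (≼-exists w))

      0≤2a : 0# ≤ 2ℝ * a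
      0≤2a = 0≤* (<⇒≤ 0<2) (proj₁ (proj₂ (≼-exists z)))

      0≤2b : 0# ≤ 2ℝ * b
      0≤2b = 0≤* (<⇒≤ 0<2) (proj₁ (proj₂ (≼-exists w)))

      Ez Ew E D : ℕ → ℂ
      Ez = ∑ᶜ (termᶜ z)
      Ew = ∑ᶜ (termᶜ w)
      E n = ∑ᶜ (termᶜ (z +ᶜ w)) n
      D n = cornerᶜ (termᶜ z) (termᶜ w) n 0

      D≼ : ∀ n → D n ≼ 2ℝ * corner (term (2ℝ * a)) (term (2ℝ * b)) n 0
      D≼ n = ≼-corner n 0 (termᶜ-≼ z≼a) (termᶜ-≼ w≼b)

      bound→0 : Null (λ n → 2ℝ * corner (term (2ℝ * a)) (term (2ℝ * b)) n 0)
      bound→0 = null-scale 2ℝ (null-corner 0≤2a 0≤2b (exp-real-limit _))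

      absorb : ∀ {s t x} → Limit s x → Null t → Limit (λ n → s n + t n) x
      absorb {s} {t} {x} s→x t→0 = null-cong
        (λ n → solve 3 (λ s t x → s :- x :+ t := s :+ t :- x) refl (s n) (t n) x) (null-+ s→x t→0)

      re-D→0 : Null (λ n → re (D n))
      re-D→0 = null-dominated (λ n → proj₁ (D≼ n)) bound→0

      im-D→0 : Null (λ n → im (D n))
      im-D→0 = null-dominated (λ n → proj₂ (D≼ n)) bound→0

      E+D→exp : Limitᶜ (λ n → E n +ᶜ D n) (exp (z +ᶜ w))
      E+D→exp = absorb {re ∘ E} {re ∘ D} (proj₁ (exp-limit (z +ᶜ w))) re-D→0
              , absorb {im ∘ E} {im ∘ D} (proj₂ (exp-limit (z +ᶜ w))) im-D→0

      split : ∀ n → E n +ᶜ D n ≈ᶜ Ez n *ᶜ Ew n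
      split n = ℂ-Ring.sym (Termᶜ.∑term*∑term z w n)

      sums→exp : Limitᶜ (λ n → Ez n *ᶜ Ew n) (exp (z +ᶜ w))
      sums→exp = limitᶜ-cong {λ n → E n +ᶜ D n} {λ n → Ez n *ᶜ Ew n} split E+D→exp

-- The exponential on the imaginary axis; sine and cosine.

module Circle {c ℓ₁ ℓ₂} (R : Reals c ℓ₁ ℓ₂)
    (exp : Analysis.ℂ R → Analysis.ℂ R) (isExp : Analysis.IsExponential R exp) where
  open Reals R
  open Analysis R
  open RealLemmas R
  open Limits R
  open Complex R
  open ExponentialSeries R
  open Exponential exp isExp
  open ℝ.Solver
  open ℝ using (∑)
  open ℝ.ExponentialTerms fact⁻¹ fact⁻¹-inverse using (term)
  open Termᶜ using () renaming (term to termᶜ)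
  open ℂ-Lemmas using () renaming (∑ to ∑ᶜ)

  conj : ℂ → ℂ
  conj z = re z +i - im z

  conj-* : ∀ z w → conj (z *ᶜ w) ≈ᶜ conj z *ᶜ conj w
  conj-* (a +i b) (c +i d) =
    solve 4 (λ a b c d → a :* c :- b :* d := a :* c :- :- b :* :- d) refl a b c d ,
    solve 4 (λ a b c d → :- (a :* d :+ b :* c) := a :* :- d :+ :- b :* c) refl a b c d

  conj-fromℝ : ∀ x → conj (fromℝ x) ≈ᶜ fromℝ x
  conj-fromℝ x = refl , solve 0 (:- con ℤ.0ℤ := con ℤ.0ℤ) refl

  conj-^ : ∀ z k → conj z ^ᶜ k ≈ᶜ conj (z ^ᶜ k)
  conj-^ z zero    = ℂ-Ring.sym (conj-fromℝ 1#)
  conj-^ z (suc k) = ℂ-Ring.trans (ℂ-Ring.*-congˡ {conj z} (conj-^ z k)) (ℂ-Ring.sym (conj-* z (z ^ᶜ k)))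

  conj-term : ∀ z k → termᶜ (conj z) k ≈ᶜ conj (termᶜ z k)
  conj-term z k = ℂ-Ring.trans
    (ℂ-Ring.*-cong (ℂ-Ring.sym (conj-fromℝ (fact⁻¹ k))) (conj-^ z k))
    (ℂ-Ring.sym (conj-* (fromℝ (fact⁻¹ k)) (z ^ᶜ k)))

  conj-∑ : ∀ u n → ∑ᶜ (conj ∘ u) n ≈ᶜ conj (∑ᶜ u n)
  conj-∑ u zero    = ℂ-Ring.sym (conj-fromℝ 0#)
  conj-∑ u (suc n) = ℂ-Ring.trans (ℂ-Ring.+-congˡ {conj (u 0)} (conj-∑ (u ∘ suc) n))
    (refl , ℝ-neg-+ (im (u 0)) (im (∑ᶜ (u ∘ suc) n)))
    where
    ℝ-neg-+ : ∀ x y → - x + - y ≈ - (x + y)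
    ℝ-neg-+ = solve 2 (λ x y → :- x :+ :- y := :- (x :+ y)) refl

  -- The coefficients of the series are real, so conjugation passes through its partial sums. This
  -- makes `cis (- x)` the conjugate of `cis x` and so yields `cos²+sin²`.
  exp-conj : ∀ z → exp (conj z) ≈ᶜ conj (exp z)
  exp-conj z = limitᶜ-unique {∑ᶜ (termᶜ (conj z))} (exp-limit (conj z))
    (limitᶜ-cong {conj ∘ ∑ᶜ (termᶜ z)} {∑ᶜ (termᶜ (conj z))}
      (λ n → ℂ-Ring.sym (ℂ-Ring.trans (ℂ-Lemmas.∑-cong n (conj-term z)) (conj-∑ (termᶜ z) n)))
      (proj₁ (exp-limit z) , limit-neg (proj₂ (exp-limit z))))

  fact⁻¹-0 : fact⁻¹ 0 ≈ 1#
  fact⁻¹-0 = trans (trans (sym (*-identityʳ _)) (*-congˡ (sym (+-identityʳ 1#)))) (fact⁻¹-inverse 0)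

  fact⁻¹-1 : fact⁻¹ 1 ≈ 1#
  fact⁻¹-1 = trans (trans (sym (*-identityʳ _)) (*-congˡ (sym (+-identityʳ 1#)))) (fact⁻¹-inverse 1)

  limit-tail : ∀ {s t x} m → Limit s x → (∀ n → t n ≈ s (m ℕ.+ n)) → Limit t x
  limit-tail m s→x t≈s = limit-cong (λ n → sym (t≈s n)) (null-subsequence (m ℕ.+_) (λ n → ℕ.m≤n+m n m) s→x)

  null-0 : Null (λ _ → 0#)
  null-0 ε 0<ε = 0 , λ _ _ → bounded-nonneg ≤-refl (<⇒≤ 0<ε)

  exp-0 : exp 0ᶜ ≈ᶜ 1ᶜ
  -- Shifted by one, since the empty partial sum is 0 while all later ones are 1.
  exp-0 = limitᶜ-unique {∑ᶜ (termᶜ 0ᶜ) ∘ suc}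
    ( limit-tail 1 (proj₁ (exp-limit 0ᶜ)) (λ n → refl) , limit-tail 1 (proj₂ (exp-limit 0ᶜ)) (λ n → refl))
    ( null-cong (λ n → sym (trans (+-congʳ (proj₁ (partial n))) (-‿inverseʳ 1#))) null-0
    , null-cong (λ n → sym (trans (+-congʳ (proj₂ (partial n))) (-‿inverseʳ 0#))) null-0)
    where
    term-suc : ∀ k → termᶜ 0ᶜ (suc k) ≈ᶜ 0ᶜ
    term-suc k = ℂ-Ring.trans (ℂ-Ring.*-congˡ {fromℝ (fact⁻¹ (suc k))} (ℂ-Ring.zeroˡ _)) (ℂ-Ring.zeroʳ _)

    ∑-0 : ∀ n → ∑ᶜ (λ _ → 0ᶜ) n ≈ᶜ 0ᶜ
    ∑-0 zero    = ℂ-Ring.refl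
    ∑-0 (suc n) = ℂ-Ring.trans (ℂ-Ring.+-identityˡ _) (∑-0 n)

    partial : ∀ n → ∑ᶜ (termᶜ 0ᶜ) (suc n) ≈ᶜ 1ᶜ
    partial n = ℂ-Ring.trans
      (ℂ-Ring.+-cong (ℂ-Ring.trans (ℂ-Ring.*-identityʳ _) (fromℝ-cong fact⁻¹-0))
                     (ℂ-Ring.trans (ℂ-Lemmas.∑-cong n term-suc) (∑-0 n)))
      (ℂ-Ring.+-identityʳ 1ᶜ)

  cis : ℝ → ℂ
  cis θ = exp (0# +i θ)

  cos sin : ℝ → ℝ
  cos = re ∘ cis
  sin = im ∘ cis

  cis-cong : ∀ {x y} → x ≈ y → cis x ≈ᶜ cis y
  cis-cong x≈y = exp-cong (refl , x≈y)

  cis-0 : cis 0# ≈ᶜ 1ᶜ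
  cis-0 = exp-0

  cis-+ : ∀ x y → cis (x + y) ≈ᶜ cis x *ᶜ cis y
  cis-+ x y = ℂ-Ring.trans (exp-cong (sym (+-identityˡ 0#) , refl)) (exp-+ (0# +i x) (0# +i y))

  cis-neg : ∀ x → cis (- x) ≈ᶜ conj (cis x)
  cis-neg x = exp-conj (0# +i x)

  cis*cis-neg : ∀ x → cis x *ᶜ cis (- x) ≈ᶜ 1ᶜ
  cis*cis-neg x = ℂ-Ring.trans (ℂ-Ring.sym (cis-+ x (- x))) (ℂ-Ring.trans (cis-cong (-‿inverseʳ x)) cis-0)

  cos²+sin² : ∀ x → cos x * cos x + sin x * sin x ≈ 1#
  cos²+sin² x = trans (solve 2 (λ a b → a :* a :+ b :* b := a :* a :- b :* :- b) refl (cos x) (sin x))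
    (proj₁ (ℂ-Ring.trans (ℂ-Ring.*-congˡ {cis x} (ℂ-Ring.sym (cis-neg x))) (cis*cis-neg x)))

  cis-isUnit : ∀ x → IsUnit (cis x)
  cis-isUnit x = cis (- x) , ℂ-Ring.trans (ℂ-Ring.*-comm _ _) (cis*cis-neg x) , cis*cis-neg x

  cis-^ : ∀ x n → cis x ^ᶜ n ≈ᶜ cis (fromℕ n * x)
  cis-^ x zero    = ℂ-Ring.trans (ℂ-Ring.sym cis-0) (cis-cong (sym (zeroˡ x)))
  cis-^ x (suc n) = ℂ-Ring.trans (ℂ-Ring.*-congˡ {cis x} (cis-^ x n)) (ℂ-Ring.trans (ℂ-Ring.sym (cis-+ x (fromℕ n * x)))
    (cis-cong (solve 2 (λ n x → x :+ n :* x := (con ℤ.1ℤ :+ n) :* x) refl (fromℕ n) x)))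

  zpow-cis : ∀ x k → zpow (cis x) (cis-isUnit x) k ≈ᶜ cis (fromℤ k * x)
  zpow-cis x (ℤ.+ n)    = cis-^ x n
  zpow-cis x ℤ.-[1+ n ] = ℂ-Ring.trans (cis-^ (- x) (suc n))
    (cis-cong (solve 2 (λ n x → n :* :- x := :- n :* x) refl (fromℕ (suc n)) x))

  -- Powers of y are at most 1, and 1/(k+1)! = (k+2)/(k+2)! is at least 2/(k+2)!. The right-hand
  -- side is chosen so that its sum telescopes.
  term-bound : ∀ {y} → 0# ≤ y → y ≤ 1# → ∀ k → term y (2 ℕ.+ k) ≤ (y * y) * (fact⁻¹ (1 ℕ.+ k) - fact⁻¹ (2 ℕ.+ k))
  term-bound {y} 0≤y y≤1 k = ≤-cong (solve 3 (λ r y p → (y :* y) :* (r :* p) := r :* (y :* (y :* p))) refl r y (y ℝ.^ k)) refl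
    (*-monoʳ-≤ (0≤* 0≤y 0≤y) (≤-trans r*y^k≤r r≤))
    where
    r = fact⁻¹ (2 ℕ.+ k)

    y^k≤1 : ∀ k → y ℝ.^ k ≤ 1#
    y^k≤1 zero    = ≤-refl
    y^k≤1 (suc k) = ≤-cong refl (*-identityʳ 1#) (*-mono-≤ (<⇒≤ 0<1) (^-nonneg k 0≤y) y≤1 (y^k≤1 k))

    r*y^k≤r : r * y ℝ.^ k ≤ r
    r*y^k≤r = ≤-cong refl (*-identityʳ r) (*-monoʳ-≤ (0≤fact⁻¹ (2 ℕ.+ k)) (y^k≤1 k))

    r≤ : r ≤ fact⁻¹ (1 ℕ.+ k) - r
    r≤ = 0≤y-x⇒x≤y (≤-cong refl
      (trans (solve 2 (λ n r → n :* r := (con ℤ.1ℤ :+ (con ℤ.1ℤ :+ n)) :* r :- r :- r) refl (fromℕ k) r)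
             (+-congʳ (+-congʳ (sym (fact⁻¹-suc (suc k))))))
      (0≤* (0≤fromℕ k) (0≤fact⁻¹ (2 ℕ.+ k))))

  -- At ix the terms of degree 0 and 1 have imaginary parts 0 and x. The later terms are bounded by
  -- those of the exponential series at 2x, the 2 being the loss in `≼-^`, and by `term-bound` they
  -- add up to at most (2x)².
  sin-lower-bound : ∀ {x} → 0# ≤ x → 2ℝ * x ≤ 1# → x - (2ℝ * x) * (2ℝ * x) ≤ sin x
  sin-lower-bound {x} 0≤x 2x≤1 = limit-≥ bound (limit-tail 2 (proj₂ (exp-limit z)) (λ n → refl))
    where
    z : ℂ
    z = 0# +i x
    y : ℝ
    y = 2ℝ * x
    u : ℕ → ℂ
    u = termᶜ z
    v : ℕ → ℝ
    v k = fact⁻¹ (suc k) - fact⁻¹ (suc (suc k))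

    z≼x : z ≼ x
    z≼x = bounded-nonneg ≤-refl 0≤x , bounded-nonneg 0≤x ≤-refl

    0≤y : 0# ≤ y
    0≤y = 0≤* (<⇒≤ 0<2) 0≤x

    tail≼ : ∀ n → ∑ᶜ (u ∘ suc ∘ suc) n ≼ ∑ (λ k → (y * y) * v k) n
    tail≼ n = ≼-∑ n (λ k → weaken k (termᶜ-≼ z≼x (suc (suc k))))
      where
      weaken : ∀ k {w} → w ≼ term y (2 ℕ.+ k) → w ≼ (y * y) * v k
      weaken k (p , q) = bounded-≤ (term-bound 0≤y 2x≤1 k) p , bounded-≤ (term-bound 0≤y 2x≤1 k) q

    ∑≤y*y : ∀ n → ∑ (λ k → (y * y) * v k) n ≤ y * y
    ∑≤y*y n = ≤-cong
      (trans (*-congˡ (sym (ℝ.∑-telescope (fact⁻¹ ∘ suc) n))) (ℝ.*-distribˡ-∑ (y * y) v n))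
      (*-identityʳ (y * y))
      (*-monoʳ-≤ (0≤* 0≤y 0≤y) (≤-trans
        (≤-cong refl (+-identityʳ _) (+-mono-≤ ≤-refl -r≤0))
        (≤-reflexive fact⁻¹-1)))
      where
      -r≤0 : - fact⁻¹ (suc n) ≤ 0#
      -r≤0 = 0≤y-x⇒x≤y (≤-cong refl (solve 1 (λ r → r := con ℤ.0ℤ :- :- r) refl _) (0≤fact⁻¹ (suc n)))

    im-u0 : im (u 0) ≈ 0#
    im-u0 = solve 1 (λ r → r :* con ℤ.0ℤ :+ con ℤ.0ℤ :* con ℤ.1ℤ := con ℤ.0ℤ) refl (fact⁻¹ 0)

    im-u1 : im (u 1) ≈ x
    im-u1 = trans (solve 2 (λ r x → r :* (con ℤ.0ℤ :* con ℤ.0ℤ :+ x :* con ℤ.1ℤ)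
        :+ con ℤ.0ℤ :* (con ℤ.0ℤ :* con ℤ.1ℤ :- x :* con ℤ.0ℤ) := r :* x) refl (fact⁻¹ 1) x)
      (trans (*-congʳ fact⁻¹-1) (*-identityˡ x))

    bound : ∀ n → x - y * y ≤ im (∑ᶜ u (2 ℕ.+ n))
    bound n = ≤-cong refl
      (trans (solve 2 (λ x t → x :+ t := con ℤ.0ℤ :+ (x :+ t)) refl x (im T)) (+-cong (sym im-u0) (+-congʳ (sym im-u1))))
      (+-mono-≤ ≤-refl -y*y≤im-T)
      where
      T : ℂ
      T = ∑ᶜ (u ∘ suc ∘ suc) n
      -y*y≤im-T : - (y * y) ≤ im T
      -y*y≤im-T = 0≤y-x⇒x≤y (≤-cong refl
        (solve 2 (λ a t → a :- :- t := t :- :- a) refl (y * y) (im T))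
        (x≤y⇒0≤y-x (≤-trans (proj₂ (proj₂ (tail≼ n))) (∑≤y*y n))))

  -- The lower bound for the sine factors as x(1 - 4x), which is positive here.
  sin-small : ∀ {x} → 0# < x → 2ℝ * 2ℝ * x < 1# → ¬ (sin x ≈ 0#)
  sin-small {x} 0<x 4x<1 sin≈0 = ≤-trans (sin-lower-bound (<⇒≤ 0<x) (<⇒≤ 2x<1)) (≤-reflexive sin≈0)
    (<-cong refl (solve 1 (λ x → x :* (con ℤ.1ℤ :- 2′ :* 2′ :* x) := x :- (2′ :* x) :* (2′ :* x)) refl x)
      (*-pos 0<x (x<y⇒0<y-x 4x<1)))
    where
    2′ : ∀ {n} → Polynomial n
    2′ = con ℤ.1ℤ :+ con ℤ.1ℤ
    2x<1 : 2ℝ * x < 1#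
    2x<1 = <.trans (<-cong (+-identityʳ _) (solve 1 (λ x → 2′ :* x :+ 2′ :* x := 2′ :* 2′ :* x) refl x)
      (+-monoʳ-< _ (*-pos 0<2 0<x))) 4x<1

-- Roots of unity and their sums.

module RootsOfUnity {r ℓ₁ ℓ₂} (R : Reals r ℓ₁ ℓ₂)
    (exp : Analysis.ℂ R → Analysis.ℂ R) (isExp : Analysis.IsExponential R exp) (π : Reals.ℝ R) (isPi : Analysis.IsPi R exp π) where
  open Reals R
  open Analysis R
  open RealLemmas R
  open Complex R
  open Circle R exp isExp
  open ℝ.Solver
  open ℂ-Lemmas using () renaming (∑ to ∑ᶜ)

  ½π 2π : ℝ
  ½π = fromℚ ½ * π
  2π = fromℕ 2 * π

  ½π+½π≈π : ½π + ½π ≈ π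
  ½π+½π≈π = trans (+-cong ½π≈half ½π≈half) (half+half π)
    where
    ½π≈half : ½π ≈ half π
    ½π≈half = *-congʳ (trans (*-congʳ (+-identityʳ 1#)) (*-identityˡ _))

  2π≈π+π : 2π ≈ π + π
  2π≈π+π = trans (*-congʳ fromℕ-2) (solve 1 (λ p → (con ℤ.1ℤ :+ con ℤ.1ℤ) :* p := p :+ p) refl π)

  sin-double : ∀ x → sin (x + x) ≈ 2ℝ * cos x * sin x
  sin-double x = trans (proj₂ (cis-+ x x))
    (solve 2 (λ c s → c :* s :+ s :* c := (con ℤ.1ℤ :+ con ℤ.1ℤ) :* c :* s) refl (cos x) (sin x))

  2≉0 : ¬ (2ℝ ≈ 0#)
  2≉0 2≈0 = <.irrefl (sym 2≈0) 0<2

  cos≉0 : ∀ {x} → 0# < x → x < ½π → ¬ (cos x ≈ 0#)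
  cos≉0 = IsPi.least isPi _

  sin-double≉0 : ∀ {x} → 0# < x → x < ½π → ¬ (sin x ≈ 0#) → ¬ (sin (x + x) ≈ 0#)
  sin-double≉0 {x} 0<x x<½π sin≉0 sin2x≈0 = sin≉0 (xy≈0⇒y≈0 (trans (sym (sin-double x)) sin2x≈0)
    λ 2cos≈0 → cos≉0 0<x x<½π (xy≈0⇒y≈0 2cos≈0 2≉0))

  -- Halve x until it is small enough for the Taylor bound; no cosine met on the way vanishes.
  sin≉0′ : ∀ n {x} → 0# < x → x < ½π → 2ℝ * 2ℝ * x < fromℕ (suc n) → ¬ (sin x ≈ 0#)
  sin≉0′ zero    0<x x<½π 4x<1 = sin-small 0<x (<-cong refl (+-identityʳ 1#) 4x<1)
  sin≉0′ (suc n) {x} 0<x x<½π 4x<2+n sin≈0 =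
    sin-double≉0 0<h h<½π (sin≉0′ n 0<h h<½π 4h<1+n)
      (trans (proj₂ (cis-cong (half+half x))) sin≈0)
    where
    h : ℝ
    h = half x
    0<h = 0<half 0<x
    h<½π = <.trans (half<x 0<x) x<½π

    2+n≤ : fromℕ (suc (suc n)) ≤ 2ℝ * fromℕ (suc n)
    2+n≤ = 0≤y-x⇒x≤y (≤-cong refl
      (solve 1 (λ n → n := (con ℤ.1ℤ :+ con ℤ.1ℤ) :* (con ℤ.1ℤ :+ n) :- (con ℤ.1ℤ :+ (con ℤ.1ℤ :+ n))) refl (fromℕ n)) (0≤fromℕ n))

    4h<1+n : 2ℝ * 2ℝ * h < fromℕ (suc n)
    4h<1+n = <-cong
      (solve 2 (λ k x → k :* (4′ :* x) := 4′ :* (k :* x)) refl (1/fromℕ 2) x)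
      (trans (sym (*-assoc _ _ _)) (trans (*-congʳ (trans (*-congˡ (sym fromℕ-2)) (1/fromℕ*fromℕ 2))) (*-identityˡ _)))
      (*-monoʳ-< (0<1/fromℕ 2) (<-≤-trans 4x<2+n 2+n≤))
      where
      4′ : ∀ {n} → Polynomial n
      4′ = (con ℤ.1ℤ :+ con ℤ.1ℤ) :* (con ℤ.1ℤ :+ con ℤ.1ℤ)

  -- The archimedean axiom bounds the number of halvings in advance, which gives the recursion of
  -- `sin≉0′` its measure.
  sin≉0 : ∀ {x} → 0# < x → x < ½π → ¬ (sin x ≈ 0#)
  sin≉0 {x} 0<x x<½π = sin≉0′ n 0<x x<½π (<.trans 4x<n (fromℕ-mono-< (ℕ.n<1+n n)))
    where
    n = proj₁ (archimedean (2ℝ * 2ℝ * x))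
    4x<n = proj₂ (archimedean (2ℝ * 2ℝ * x))

  -- With c and s the cosine and sine of 2x, the real part of the equation reads c² - s² = 1.
  -- Subtracting it from c² + s² = 1 leaves 2s² = 0.
  cis-quadruple≉1 : ∀ {x} → 0# < x → x < ½π → ¬ (cis ((x + x) + (x + x)) ≈ᶜ 1ᶜ)
  cis-quadruple≉1 {x} 0<x x<½π cis≈1 = sin-double≉0 0<x x<½π (sin≉0 0<x x<½π) s≈0
    where
    c s : ℝ
    c = cos (x + x)
    s = sin (x + x)
    2s²≈0 : 2ℝ * (s * s) ≈ 0#
    2s²≈0 = trans (solve 2 (λ c s → (con ℤ.1ℤ :+ con ℤ.1ℤ) :* (s :* s) := (c :* c :+ s :* s) :- (c :* c :- s :* s)) refl c s)
      (trans (+-cong (cos²+sin² (x + x)) (-‿cong (trans (sym (proj₁ (cis-+ (x + x) (x + x)))) (proj₁ cis≈1))))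
        (-‿inverseʳ 1#))
    s≈0 : s ≈ 0#
    s≈0 = x*x≈0⇒x≈0 (xy≈0⇒y≈0 2s²≈0 2≉0)

  -- As the cosine vanishes at π/2, the Pythagorean identity makes the squared sine equal to 1
  -- there. Squaring `cis ½π` thus gives -1 without any knowledge of the sign of the sine.
  cis-2π : cis 2π ≈ᶜ 1ᶜ
  cis-2π = ℂ-Ring.trans (cis-cong 2π≈π+π) (ℂ-Ring.trans (cis-+ π π)
    (ℂ-Ring.trans (ℂ-Ring.*-cong cis-π cis-π)
      ( solve 0 (:- con ℤ.1ℤ :* :- con ℤ.1ℤ :- con ℤ.0ℤ :* con ℤ.0ℤ := con ℤ.1ℤ) refl
      , solve 0 (:- con ℤ.1ℤ :* con ℤ.0ℤ :+ con ℤ.0ℤ :* :- con ℤ.1ℤ := con ℤ.0ℤ) refl)))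
    where
    c s : ℝ
    c = cos ½π
    s = sin ½π
    c≈0 : c ≈ 0#
    c≈0 = IsPi.cos-π/2 isPi
    cis-π : cis π ≈ᶜ (- 1# +i 0#)
    cis-π = ℂ-Ring.trans (ℂ-Ring.trans (cis-cong (sym ½π+½π≈π)) (cis-+ ½π ½π))
      ( trans (solve 2 (λ c s → c :* c :- s :* s := (c :+ c) :* c :- (c :* c :+ s :* s)) refl c s)
          (trans (+-cong (trans (*-congˡ c≈0) (zeroʳ _)) (-‿cong (cos²+sin² ½π))) (+-identityˡ _))
      , trans (+-cong (trans (*-congʳ c≈0) (zeroˡ s)) (trans (*-congˡ c≈0) (zeroʳ s))) (+-identityˡ 0#))

  cis-neg≈1 : ∀ {x} → cis x ≈ᶜ 1ᶜ → cis (- x) ≈ᶜ 1ᶜ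
  cis-neg≈1 {x} cis≈1 = ℂ-Ring.trans (ℂ-Ring.sym (ℂ-Ring.*-identityˡ _))
    (ℂ-Ring.trans (ℂ-Ring.*-congʳ {cis (- x)} (ℂ-Ring.sym cis≈1)) (cis*cis-neg x))

  cis-2πn : ∀ n → cis (2π * fromℕ n) ≈ᶜ 1ᶜ
  cis-2πn zero    = ℂ-Ring.trans (cis-cong (zeroʳ 2π)) cis-0
  cis-2πn (suc n) = ℂ-Ring.trans
    (cis-cong (solve 2 (λ p n → p :* (con ℤ.1ℤ :+ n) := p :+ p :* n) refl 2π (fromℕ n)))
    (ℂ-Ring.trans (cis-+ 2π (2π * fromℕ n)) (ℂ-Ring.trans (ℂ-Ring.*-cong cis-2π (cis-2πn n)) (ℂ-Ring.*-identityˡ 1ᶜ)))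

  cis-2πk : ∀ k → cis (2π * fromℤ k) ≈ᶜ 1ᶜ
  cis-2πk (ℤ.+ n)    = cis-2πn n
  cis-2πk ℤ.-[1+ n ] = ℂ-Ring.trans
    (cis-cong (solve 2 (λ p n → p :* :- n := :- (p :* n)) refl 2π (fromℕ (suc n))))
    (cis-neg≈1 (cis-2πn (suc n)))

  -- Multiplication by the conjugate of z turns the equation into two real ones with the factor a² +
  -- b², and this sum of squares vanishes only together with z.
  integral-domain : ∀ {z w} → z *ᶜ w ≈ᶜ 0ᶜ → ¬ (z ≈ᶜ 0ᶜ) → w ≈ᶜ 0ᶜ
  integral-domain {a +i b} {p +i q} (re≈0 , im≈0) z≉0 =
    xy≈0⇒y≈0 (annihilate re≈0 im≈0 (solve 4 (λ a b p q → a :* (a :* p :- b :* q) :+ b :* (a :* q :+ b :* p)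
                                                := (a :* a :+ b :* b) :* p) refl a b p q)) norm≉0 ,
    xy≈0⇒y≈0 (annihilate im≈0 re≈0 (solve 4 (λ a b p q → a :* (a :* q :+ b :* p) :+ :- b :* (a :* p :- b :* q)
                                                := (a :* a :+ b :* b) :* q) refl a b p q)) norm≉0
    where
    annihilate : ∀ {x y s t u} → x ≈ 0# → y ≈ 0# → s * x + t * y ≈ u → u ≈ 0#
    annihilate {s = s} {t} x≈0 y≈0 eq = trans (sym eq)
      (trans (+-cong (trans (*-congˡ x≈0) (zeroʳ s)) (trans (*-congˡ y≈0) (zeroʳ t))) (+-identityˡ 0#))
    norm≉0 : ¬ (a * a + b * b ≈ 0#)
    norm≉0 norm≈0 = z≉0
      ( x*x≈0⇒x≈0 (x+y≈0⇒x≈0 (0≤x*x a) (0≤x*x b) norm≈0)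
      , x*x≈0⇒x≈0 (x+y≈0⇒x≈0 (0≤x*x b) (0≤x*x a) (trans (+-comm _ _) norm≈0)))

  module _ (l : ℕ) .{{_ : ℕ.NonZero l}} where

    angle : ℤ → ℝ
    angle k = 2π * fromℤ k * 1/fromℕ l

    angle*l : ∀ k → angle k * fromℕ l ≈ 2π * fromℤ k
    angle*l k = trans (*-assoc _ _ _) (trans (*-congˡ (1/fromℕ*fromℕ l)) (*-identityʳ _))

    angle-pos≉1 : ∀ n → suc n ℕ.< l → ¬ (cis (angle (ℤ.+ suc n)) ≈ᶜ 1ᶜ)
    angle-pos≉1 n n<l cis≈1 = cis-quadruple≉1 0<h h<½π (ℂ-Ring.trans (cis-cong 4h≈angle) cis≈1)
      where
      q h : ℝ
      q = fromℕ (suc n) * 1/fromℕ l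
      -- A quarter of the angle; `n<l` makes q less than 1.
      h = ½π * q

      0<½π : 0# < ½π
      0<½π = *-pos (<-cong refl (sym (trans (*-congʳ (+-identityʳ 1#)) (*-identityˡ _))) (0<1/fromℕ 2)) (IsPi.positive isPi)

      0<h : 0# < h
      0<h = *-pos 0<½π (*-pos (0<fromℕ (suc n)) (0<1/fromℕ l))

      h<½π : h < ½π
      h<½π = <-cong refl (*-identityʳ ½π) (*-monoʳ-< 0<½π
        (<-cong (*-comm _ _) (1/fromℕ*fromℕ l) (*-monoʳ-< (0<1/fromℕ l) (fromℕ-mono-< n<l))))

      4h≈angle : (h + h) + (h + h) ≈ angle (ℤ.+ suc n)
      4h≈angle = trans
        (solve 3 (λ p n r → (p :* (n :* r) :+ p :* (n :* r)) :+ (p :* (n :* r) :+ p :* (n :* r))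
                          := ((p :+ p) :+ (p :+ p)) :* n :* r) refl ½π (fromℕ (suc n)) (1/fromℕ l))
        (*-congʳ (*-congʳ (trans (+-cong ½π+½π≈π ½π+½π≈π) (sym 2π≈π+π))))

    angle≉1 : ∀ k → k ≢ 0ℤ → ℤ.∣ k ∣ ℕ.< l → ¬ (cis (angle k) ≈ᶜ 1ᶜ)
    angle≉1 (ℤ.+ zero)   k≢0 k<l = ⊥-elim (k≢0 ≡.refl)
    angle≉1 ℤ.+[1+ n ]   k≢0 k<l = angle-pos≉1 n k<l
    angle≉1 ℤ.-[1+ n ]   k≢0 k<l cis≈1 = angle-pos≉1 n k<l (ℂ-Ring.trans
      (cis-cong (solve 3 (λ p n r → p :* n :* r := :- (p :* :- n :* r)) refl 2π (fromℕ (suc n)) (1/fromℕ l)))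
      (cis-neg≈1 cis≈1))

    rootSum : ℤ → ℂ
    rootSum k = ∑ᶜ (λ m → cis (angle k * fromℕ (suc m))) l

    -- With ω = cis (angle k), the product of 1 - ω and the sum telescopes, and its two ends agree by periodicity.
    rootSum≈0 : ∀ k → k ≢ 0ℤ → ℤ.∣ k ∣ ℕ.< l → rootSum k ≈ᶜ 0ᶜ
    rootSum≈0 k k≢0 k<l = integral-domain {1ᶜ +ᶜ -ᶜ ω} {rootSum k} [1-ω]S≈0 1-ω≉0
      where
      open ℂ-Lemmas.Solver using () renaming (solve to solveᶜ; _:+_ to _⊕_; _:*_ to _⊗_; _:-_ to _⊖_; _:=_ to _⊜_; con to conᶜ)
      ω : ℂ
      ω = cis (angle k)
      g : ℕ → ℂ
      g m = cis (angle k * fromℕ m)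

      g-suc : ∀ m → g (suc m) ≈ᶜ ω *ᶜ g m
      g-suc m = ℂ-Ring.trans
        (cis-cong (solve 2 (λ a m → a :* (con ℤ.1ℤ :+ m) := a :+ a :* m) refl (angle k) (fromℕ m)))
        (cis-+ (angle k) (angle k * fromℕ m))

      g-1≈g-1+l : g 1 ≈ᶜ g (suc l)
      g-1≈g-1+l = ℂ-Ring.trans (g-suc 0) (ℂ-Ring.trans
        (ℂ-Ring.*-congˡ {ω} (ℂ-Ring.trans (ℂ-Ring.trans (cis-cong (zeroʳ _)) cis-0)
          (ℂ-Ring.sym (ℂ-Ring.trans (cis-cong (angle*l k)) (cis-2πk k)))))
        (ℂ-Ring.sym (g-suc l)))

      factor : ∀ m → (1ᶜ +ᶜ -ᶜ ω) *ᶜ g (suc m) ≈ᶜ g (suc m) +ᶜ -ᶜ g (suc (suc m))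
      factor m = ℂ-Ring.trans
        (solveᶜ 2 (λ w x → (conᶜ ℤ.1ℤ ⊖ w) ⊗ x ⊜ x ⊖ w ⊗ x) ℂ-Ring.refl ω (g (suc m)))
        (ℂ-Ring.+-congˡ {g (suc m)} (ℂ-Ring.-‿cong (ℂ-Ring.sym (g-suc (suc m)))))

      [1-ω]S≈0 : (1ᶜ +ᶜ -ᶜ ω) *ᶜ rootSum k ≈ᶜ 0ᶜ
      [1-ω]S≈0 = ℂ-Ring.trans (ℂ-Lemmas.*-distribˡ-∑ (1ᶜ +ᶜ -ᶜ ω) (g ∘ suc) l)
        (ℂ-Ring.trans (ℂ-Lemmas.∑-cong l factor)
        (ℂ-Ring.trans (ℂ-Lemmas.∑-telescope (g ∘ suc) l)
        (ℂ-Ring.trans (ℂ-Ring.+-congʳ { -ᶜ g (suc l)} g-1≈g-1+l) (ℂ-Ring.-‿inverseʳ (g (suc l))))))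

      1-ω≉0 : ¬ (1ᶜ +ᶜ -ᶜ ω ≈ᶜ 0ᶜ)
      1-ω≉0 1-ω≈0 = angle≉1 k k≢0 k<l (ℂ-Ring.trans
        (solveᶜ 1 (λ w → w ⊜ conᶜ ℤ.1ℤ ⊖ (conᶜ ℤ.1ℤ ⊖ w)) ℂ-Ring.refl ω)
        (ℂ-Ring.trans (ℂ-Ring.+-congˡ {1ᶜ} (ℂ-Ring.-‿cong 1-ω≈0))
          (solveᶜ 0 (conᶜ ℤ.1ℤ ⊖ conᶜ ℤ.0ℤ ⊜ conᶜ ℤ.1ℤ) ℂ-Ring.refl)))

    rootSum-0 : rootSum 0ℤ ≈ᶜ fromℝ (fromℕ l)
    rootSum-0 = ℂ-Ring.trans (ℂ-Lemmas.∑-cong l (λ m → ℂ-Ring.trans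
      (cis-cong (solve 3 (λ p r m → p :* con ℤ.0ℤ :* r :* m := con ℤ.0ℤ) refl 2π (1/fromℕ l) (fromℕ (suc m)))) cis-0))
      (ℂ-Ring.trans (ones l) (ℂ-Ring.sym (fromℝ-fromℕ l)))
      where
      ones : ∀ n → ∑ᶜ (λ _ → 1ᶜ) n ≈ᶜ n ℂ-Lemmas.⋅ 1ᶜ
      ones zero    = ℂ-Ring.refl
      ones (suc n) = ℂ-Ring.+-congˡ {1ᶜ} (ones n)

-- Exponents occurring in the logical form.

all-cartesianProductWith : ∀ {a b c p q r} {A : Set a} {B : Set b} {C : Set c}
  {P : A → Set p} {Q : B → Set q} {R : C → Set r} {f : A → B → C} →
  (∀ {x y} → P x → Q y → R (f x y)) →
  ∀ {xs ys} → All P xs → All Q ys → All R (cartesianProductWith f xs ys)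
all-cartesianProductWith PQ⇒R []         qs = []
all-cartesianProductWith PQ⇒R (px ∷ pxs) qs =
  All.++⁺ (All.map⁺ (All.map (PQ⇒R px) qs)) (all-cartesianProductWith PQ⇒R pxs qs)

module _ {n : ℕ} where
  open RawRing (laurentRing n)
  open Algebra.Definitions.RawSemiring rawSemiring using (product)

  -- The condition concerns every listed term, even terms that cancel each other, so like terms
  -- never have to be collected.
  record Exponents (P : Fin n → ℤ → Set) (f : Laurent n) : Set where
    constructor exponents
    field
      all : All (λ t → ∀ j → P j (lookup (proj₂ t) j)) f
  open Exponents public

  -- The set U records which variables may occur at all. Only when these sets are disjoint do the
  -- exponents of a product stay within 0 and s instead of reaching 2s.
  ZeroOr : ℤ → (Fin n → Set) → Fin n → ℤ → Set
  ZeroOr s U j k = k ≡ 0ℤ ⊎ (k ≡ s × U j)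

  Simple : ℤ → (Fin n → Set) → Laurent n → Set
  Simple s U = Exponents (ZeroOr s U)

  zeroOr-weaken : ∀ {s U V j k} → (U j → V j) → ZeroOr s U j k → ZeroOr s V j k
  zeroOr-weaken U⊆V (inj₁ k≡0)       = inj₁ k≡0
  zeroOr-weaken U⊆V (inj₂ (k≡s , u)) = inj₂ (k≡s , U⊆V u)

  simple-weaken : ∀ {s U V f} → (∀ {j} → U j → V j) → Simple s U f → Simple s V f
  simple-weaken {s} {U} {V} U⊆V h =
    exponents (All.map (λ p j → zeroOr-weaken {s} {U} {V} U⊆V (p j)) (all h))

  exponents-+ : ∀ {P} f g → Exponents P f → Exponents P g → Exponents P (f + g)
  exponents-+ f g p q = exponents (All.++⁺ (all p) (all q))

  exponents-neg : ∀ {P} f → Exponents P f → Exponents P (- f)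
  exponents-neg f p = exponents (All.map⁺ (all p))

  exponents-* : ∀ {P Q S} f g → (∀ {j k m} → P j k → Q j m → S j (k ℤ.+ m)) →
                Exponents P f → Exponents Q g → Exponents S (f * g)
  exponents-* {P} {Q} {S} f g PQ⇒S p q = exponents (all-cartesianProductWith (λ {x} {y} → combined {x} {y}) (all p) (all q))
    where
    combined : ∀ {x y : ℚ × Vec ℤ n} → (∀ j → P j (lookup (proj₂ x) j)) → (∀ j → Q j (lookup (proj₂ y) j)) →
               ∀ j → S j (lookup (zipWith ℤ._+_ (proj₂ x) (proj₂ y)) j)
    combined {x} {y} p q j =
      ≡.subst (S j) (≡.sym (lookup-zipWith ℤ._+_ j (proj₂ x) (proj₂ y))) (PQ⇒S {j} (p j) (q j))

  exponents-const : ∀ {P} q → (∀ j → P j 0ℤ) → Exponents P (const q)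
  exponents-const {P} q p0 = exponents ((λ j → ≡.subst (P j) (≡.sym (lookup-replicate j 0ℤ)) (p0 j)) ∷ [])

  simple-const : ∀ {s U} q → Simple s U (const q)
  simple-const q = exponents-const q (λ _ → inj₁ ≡.refl)

  -- The exponent function of `power` is local to it. Here unification recovers that function, so
  -- that `power-exponent` can repeat its case distinction.
  power-tabulated : ∀ j s → ∃[ f ] power j s ≡ (ℚ.1ℚ , tabulate {n = n} f) ∷ []
  power-tabulated j s = _ , ≡.refl

  power-exponent : ∀ j s i → ZeroOr s (_≡ j) i (proj₁ (power-tabulated j s) i)
  power-exponent j s i with i Fin.≟ j
  ... | yes i≡j = inj₂ (≡.refl , i≡j)
  ... | no  _   = inj₁ ≡.refl

  simple-power : ∀ j s → Simple s (_≡ j) (power j s)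
  simple-power j s = exponents ((λ i → ≡.subst (ZeroOr s (_≡ j) i)
    (≡.sym (lookup∘tabulate (proj₁ (power-tabulated j s)) i)) (power-exponent j s i)) ∷ [])

  simple-* : ∀ {s U V} f g → (∀ {j} → U j → ¬ V j) →
             Simple s U f → Simple s V g → Simple s (λ j → U j ⊎ V j) (f * g)
  simple-* {s} {U} {V} f g disjoint = exponents-* f g add
    where
    add : ∀ {j k m} → ZeroOr s U j k → ZeroOr s V j m → ZeroOr s (λ j → U j ⊎ V j) j (k ℤ.+ m)
    add (inj₁ ≡.refl)       (inj₁ ≡.refl)       = inj₁ ≡.refl
    add (inj₁ ≡.refl)       (inj₂ (≡.refl , v)) = inj₂ (ℤ.+-identityˡ s , inj₂ v)
    add (inj₂ (≡.refl , u)) (inj₁ ≡.refl)       = inj₂ (ℤ.+-identityʳ s , inj₁ u)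
    add (inj₂ (_ , u))      (inj₂ (_ , v))      = ⊥-elim (disjoint u v)

  simple-const* : ∀ {s U} q f → Simple s U f → Simple s U (const q * f)
  simple-const* {s} {U} q f p = simple-weaken (λ { (inj₂ u) → u })
    (simple-* (const q) f (λ ()) (simple-const {U = λ _ → ⊥} q) p)

  simple-product : ∀ {s m} {U : Fin m → Fin n → Set} (F : Fin m → Laurent n) →
                   (∀ {c d j} → U c j → U d j → c ≡ d) → (∀ c → Simple s (U c) (F c)) →
                   Simple s (λ j → ∃[ c ] U c j) (product F)
  simple-product {m = zero}      F disjoint simple = simple-const ℚ.1ℚ
  simple-product {m = suc m} {U} F disjoint simple = simple-weaken
    (λ { (inj₁ u) → Fin.zero , u ; (inj₂ (c , u)) → Fin.suc c , u })
    (simple-* (F Fin.zero) (product (F ∘ Fin.suc)) (λ { u (c , v) → zero≢suc (disjoint u v) })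
      (simple Fin.zero)
      (simple-product {U = U ∘ Fin.suc} (F ∘ Fin.suc) (λ u v → Fin.suc-injective (disjoint u v)) (simple ∘ Fin.suc)))
    where
    zero≢suc : ∀ {c : Fin m} → Fin.zero ≢ Fin.suc c
    zero≢suc ()

  -- Disjointness comes from the list having no repetitions: the head a does not occur among the
  -- variables of the tail.
  simple-foldr : ∀ {s} (g : Fin n → Laurent n) {L} → (∀ a → Simple s (_≡ a) (g a)) → Unique L →
                 Simple s (_∈ L) (foldr (λ a f → g a * f) 1# L)
  simple-foldr g {[]}    simple []             = simple-const ℚ.1ℚ
  simple-foldr g {a ∷ L} simple (a∉L ∷ unique) = simple-weaken
    (λ { (inj₁ j≡a) → here j≡a ; (inj₂ j∈L) → there j∈L })
    (simple-* (g a) (foldr (λ a f → g a * f) 1# L) (λ { ≡.refl a∈L → All.lookup a∉L a∈L ≡.refl })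
      (simple a) (simple-foldr g simple unique))

-- Stated as membership in the very list from which `signVectors` is built, so that `∈-signVectors`
-- needs no case distinction.
SignExponent : ℤ → Set
SignExponent k = k ∈ (-1ℤ ∷ 0ℤ ∷ 1ℤ ∷ [])

-- Each occurrence lies in one clause and belongs to one old variable. Since `clauseOf` and
-- `variableOf` are functions, the factors within either product involve disjoint sets of
-- occurrences.
logicalForm-exponents : ∀ {M N} (φ : 3CNF M N) → Exponents (λ _ → SignExponent) (logicalForm φ)
logicalForm-exponents {M} {N} φ = exponents-+ (q * product clause * product oldVariable) (- const ℚ.1ℚ)
  (exponents-* (q * product clause) (product oldVariable) (λ {j} → add {λ j → ∃[ c ] clauseOf j ≡ c} {λ j → ∃[ s ] variableOf j ≡ s} {j})
    (simple-const* q₀ (product clause) (simple-product clause (λ { ≡.refl ≡.refl → ≡.refl }) clause-simple))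
    (simple-product oldVariable (λ { ≡.refl ≡.refl → ≡.refl }) oldVariable-simple))
  (exponents-neg (const ℚ.1ℚ) (exponents-const ℚ.1ℚ (λ _ → there (here ≡.refl))))
  where
  n = M ℕ.* 3
  open RawRing (laurentRing n)
  open Algebra.Definitions.RawSemiring rawSemiring using (product)

  q₀ : ℚ
  q₀ = (ℤ.+ 1 ℚ./ (2 ℕ.^ (6 ℕ.* M ℕ.∸ 1))) {{ℕ.m^n≢0 2 (6 ℕ.* M ℕ.∸ 1)}}

  q : Laurent n
  q = const q₀

  add : ∀ {U V j k m} → ZeroOr 1ℤ U j k → ZeroOr -1ℤ V j m → SignExponent (k ℤ.+ m)
  add (inj₁ ≡.refl)       (inj₁ ≡.refl)       = there (here ≡.refl)
  add (inj₁ ≡.refl)       (inj₂ (≡.refl , _)) = here ≡.refl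
  add (inj₂ (≡.refl , _)) (inj₁ ≡.refl)       = there (there (here ≡.refl))
  add (inj₂ (≡.refl , _)) (inj₂ (≡.refl , _)) = there (here ≡.refl)

  -- `literalAt`, `clause`, `occurrences`, `ε/X` and `oldVariable` restate the local definitions of
  -- `logicalForm` and agree with them by computation.
  literalAt : Fin n → Literal N
  literalAt a = let c , p = remQuot 3 a in 3CNF.literal φ c p

  clauseOf : Fin n → Fin M
  clauseOf a = proj₁ (remQuot 3 a)

  variableOf : Fin n → Fin N
  variableOf a = Literal.variable′ (literalAt a)

  X-1 : Fin M → Fin 3 → Laurent n
  X-1 c p = power (combine c p) 1ℤ + - 1#

  clause : Fin M → Laurent n
  clause c = X-1 c 0F * X-1 c 1F * X-1 c 2F + const (ℤ.+ 8 ℚ./ 1)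

  X-1-simple : ∀ c p → Simple 1ℤ (_≡ combine c p) (X-1 c p)
  X-1-simple c p = exponents-+ (power (combine c p) 1ℤ) (- 1#)
    (simple-power (combine c p) 1ℤ) (exponents-neg 1# (simple-const ℚ.1ℚ))

  clause-simple : ∀ c → Simple 1ℤ (λ j → clauseOf j ≡ c) (clause c)
  clause-simple c = exponents-+ (X-1 c 0F * X-1 c 1F * X-1 c 2F) (const (ℤ.+ 8 ℚ./ 1))
    (simple-weaken (λ { (inj₁ (inj₁ p)) → inClause p ; (inj₁ (inj₂ p)) → inClause p ; (inj₂ p) → inClause p })
      (simple-* (X-1 c 0F * X-1 c 1F) (X-1 c 2F)
        (λ { (inj₁ p) → distinct (λ ()) p ; (inj₂ p) → distinct (λ ()) p })
        (simple-* (X-1 c 0F) (X-1 c 1F) (distinct (λ ())) (X-1-simple c 0F) (X-1-simple c 1F))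
        (X-1-simple c 2F)))
    (simple-const (ℤ.+ 8 ℚ./ 1))
    where
    distinct : ∀ {j} {p q : Fin 3} → p ≢ q → j ≡ combine c p → j ≢ combine c q
    distinct {p = p} {q} p≢q j≡cp j≡cq = p≢q (proj₂ (Fin.combine-injective c p c q (≡.trans (≡.sym j≡cp) j≡cq)))

    inClause : ∀ {j p} → j ≡ combine c p → clauseOf j ≡ c
    inClause {p = p} ≡.refl = ≡.cong proj₁ (Fin.remQuot-combine c p)

  occurrences : Fin N → List (Fin n)
  occurrences s = filter (λ a → variableOf a Fin.≟ s) (allFin n)

  sign : Fin n → ℚ
  sign a = (Literal.sign (literalAt a) ℤ.◃ 1) ℚ./ 1

  ε/X : Fin n → Laurent n
  ε/X a = const (sign a) * power a -1ℤ

  oldVariable : Fin N → Laurent n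
  oldVariable s =
      foldr (λ a f → (ε/X a + 1#) * f) 1# (occurrences s)
    + foldr (λ a f → (- ε/X a + 1#) * f) 1# (occurrences s)

  ε/X-simple : ∀ a → Simple -1ℤ (_≡ a) (ε/X a)
  ε/X-simple a = simple-const* (sign a) (power a -1ℤ) (simple-power a -1ℤ)

  oldVariable-simple : ∀ s → Simple -1ℤ (λ j → variableOf j ≡ s) (oldVariable s)
  oldVariable-simple s = exponents-+ (foldr (λ a f → (ε/X a + 1#) * f) 1# (occurrences s)) _
    (simple-weaken member (simple-foldr (λ a → ε/X a + 1#)
      (λ a → exponents-+ (ε/X a) 1# (ε/X-simple a) (simple-const ℚ.1ℚ)) unique))
    (simple-weaken member (simple-foldr (λ a → - ε/X a + 1#)
      (λ a → exponents-+ (- ε/X a) 1# (exponents-neg (ε/X a) (ε/X-simple a)) (simple-const ℚ.1ℚ)) unique))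
    where
    unique : Unique (occurrences s)
    unique = Unique.filter⁺ (λ a → variableOf a Fin.≟ s) (Unique.allFin⁺ n)

    member : ∀ {j} → j ∈ occurrences s → variableOf j ≡ s
    member j∈ = proj₂ (∈-filter⁻ (λ a → variableOf a Fin.≟ s) {xs = allFin n} j∈)

∈-signVectors : ∀ {n} (e : Vec ℤ n) → (∀ j → SignExponent (lookup e j)) → e ∈ signVectors n
∈-signVectors []      sign = here ≡.refl
∈-signVectors (k ∷ e) sign = ∈-cartesianProductWith⁺ _∷_ (sign Fin.zero) (∈-signVectors e (sign ∘ Fin.suc))

maxFreqℤ-bound : ∀ {n} (za zb : Fin n → ℤ) {e} → e ∈ freqVectors n →
                 ℤ.∣ freqℤ za e ∣ ℕ.⊔ ℤ.∣ freqℤ zb e ∣ ℕ.≤ maxFreqℤ za zb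
maxFreqℤ-bound {n} za zb e∈ = All.lookup
  (Extrema.xs≤max 0 (map (λ e → ℤ.∣ freqℤ za e ∣ ℕ.⊔ ℤ.∣ freqℤ zb e ∣) (freqVectors n))) (∈-map⁺ _ e∈)

-- Turns the case distinction inside `coefficient` into a disjunction on which `∑²-eval` can branch.
coefficient-∷ : ∀ {n} (e : Vec ℤ n) q d f →
  (d ≡ e × coefficient e ((q , d) ∷ f) ≡ q ℚ.+ coefficient e f) ⊎
  (d ≢ e × coefficient e ((q , d) ∷ f) ≡ coefficient e f)
coefficient-∷ e q d f with ≡-dec ℤ._≟_ d e
... | yes d≡e = inj₁ (d≡e , ≡.refl)
... | no  d≢e = inj₂ (d≢e , ≡.refl)

∈-freqVectors : ∀ {n} (e : Vec ℤ n) → (∀ j → SignExponent (lookup e j)) → e ≢ replicate n 0ℤ → e ∈ freqVectors n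
∈-freqVectors {n} e sign e≢0 = ∈-filter⁺ (λ e → ¬? (≡-dec ℤ._≟_ e (replicate n 0ℤ))) (∈-signVectors e sign) e≢0

freqℤ-0 : ∀ {n} (z : Fin n → ℤ) → freqℤ z (replicate n 0ℤ) ≡ 0ℤ
freqℤ-0 {zero}  z = ≡.refl
freqℤ-0 {suc n} z = ≡.trans (ℤ.+-identityˡ _) (freqℤ-0 (z ∘ Fin.suc))

-- Integers and rationals inside the reals.

module Numbers {r ℓ₁ ℓ₂} (R : Reals r ℓ₁ ℓ₂) where
  open Reals R
  open RealLemmas R
  open ℝ.Solver

  fromℤ≈ι : ∀ k → fromℤ k ≈ ℝ.ι k
  fromℤ≈ι (ℤ.+ n)    = refl
  fromℤ≈ι ℤ.-[1+ n ] = refl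

  fromℤ-+ : ∀ j k → fromℤ (j ℤ.+ k) ≈ fromℤ j + fromℤ k
  fromℤ-+ j k = trans (fromℤ≈ι (j ℤ.+ k)) (trans (ℝ.ι-+ j k) (sym (+-cong (fromℤ≈ι j) (fromℤ≈ι k))))

  fromℤ-* : ∀ j k → fromℤ (j ℤ.* k) ≈ fromℤ j * fromℤ k
  fromℤ-* j k = trans (fromℤ≈ι (j ℤ.* k)) (trans (ℝ.ι-* j k) (sym (*-cong (fromℤ≈ι j) (fromℤ≈ι k))))

  fromℚ*↧ : ∀ q → fromℚ q * fromℤ (↧ q) ≈ fromℤ (↥ q)
  fromℚ*↧ q = trans (*-assoc _ _ _) (trans (*-congˡ (1/fromℕ*fromℕ (↧ₙ q))) (*-identityʳ _))

  fromℕ-cancel : ∀ n .{{_ : ℕ.NonZero n}} {x y} → x * fromℕ n ≈ y * fromℕ n → x ≈ y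
  fromℕ-cancel n {x} {y} xn≈yn = trans (unit x) (trans (*-congʳ xn≈yn) (sym (unit y)))
    where
    unit : ∀ x → x ≈ x * fromℕ n * 1/fromℕ n
    unit x = trans (sym (*-identityʳ x)) (trans (*-congˡ (trans (sym (1/fromℕ*fromℕ n)) (*-comm _ _))) (sym (*-assoc _ _ _)))

  -- Addition of rationals reduces to lowest terms, so the numerators and denominators are related
  -- only by cross multiplication.
  ↥↧-+ : ∀ p q → ↥ (p ℚ.+ q) ℤ.* (↧ p ℤ.* ↧ q) ≡ (↥ p ℤ.* ↧ q ℤ.+ ↥ q ℤ.* ↧ p) ℤ.* ↧ (p ℚ.+ q)
  ↥↧-+ p q = cross-multiply p q (p ℚ.+ q) (ℚ.toℚᵘ-homo-+ p q)
    where
    -- The sum is generalised to s so that all three rationals can be matched, which lets `toℚᵘ`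
    -- compute.
    cross-multiply : ∀ p q s → ℚ.toℚᵘ s ℚᵘ.≃ ℚ.toℚᵘ p ℚᵘ.+ ℚ.toℚᵘ q →
                     ↥ s ℤ.* (↧ p ℤ.* ↧ q) ≡ (↥ p ℤ.* ↧ q ℤ.+ ↥ q ℤ.* ↧ p) ℤ.* ↧ s
    cross-multiply p@record{} q@record{} s@record{} (ℚᵘ.*≡* eq) = eq

  fromℚ-+ : ∀ p q → fromℚ (p ℚ.+ q) ≈ fromℚ p + fromℚ q
  fromℚ-+ p q = fromℕ-cancel (↧ₙ p) (fromℕ-cancel (↧ₙ q) (fromℕ-cancel (↧ₙ (p ℚ.+ q)) (begin
    S * a * b * d
      ≈⟨ solve 4 (λ s a b d → s :* a :* b :* d := (s :* d) :* (a :* b)) refl S a b d ⟩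
    (S * d) * (a * b)
      ≈⟨ *-cong (fromℚ*↧ (p ℚ.+ q)) (sym (fromℤ-* (↧ p) (↧ q))) ⟩
    fromℤ (↥ (p ℚ.+ q)) * fromℤ (↧ p ℤ.* ↧ q)
      ≈⟨ fromℤ-* (↥ (p ℚ.+ q)) (↧ p ℤ.* ↧ q) ⟨
    fromℤ (↥ (p ℚ.+ q) ℤ.* (↧ p ℤ.* ↧ q))
      ≡⟨ ≡.cong fromℤ (↥↧-+ p q) ⟩
    fromℤ ((↥ p ℤ.* ↧ q ℤ.+ ↥ q ℤ.* ↧ p) ℤ.* ↧ (p ℚ.+ q))
      ≈⟨ trans (fromℤ-* (↥ p ℤ.* ↧ q ℤ.+ ↥ q ℤ.* ↧ p) (↧ (p ℚ.+ q)))
           (*-congʳ (trans (fromℤ-+ (↥ p ℤ.* ↧ q) (↥ q ℤ.* ↧ p)) (+-cong (fromℤ-* (↥ p) (↧ q)) (fromℤ-* (↥ q) (↧ p))))) ⟩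
    (fromℤ (↥ p) * b + fromℤ (↥ q) * a) * d
      ≈⟨ *-congʳ (+-cong (*-congʳ (sym (fromℚ*↧ p))) (*-congʳ (sym (fromℚ*↧ q)))) ⟩
    (P * a * b + Q * b * a) * d
      ≈⟨ solve 5 (λ p q a b d → (p :* a :* b :+ q :* b :* a) :* d := (p :+ q) :* a :* b :* d) refl P Q a b d ⟩
    (P + Q) * a * b * d ∎)))
    where
    open import Relation.Binary.Reasoning.Setoid (CommutativeRing.setoid commutativeRing)
    S = fromℚ (p ℚ.+ q)
    P = fromℚ p
    Q = fromℚ q
    a = fromℤ (↧ p)
    b = fromℤ (↧ q)
    d = fromℤ (↧ (p ℚ.+ q))

  fromℚ-0 : fromℚ ℚ.0ℚ ≈ 0#
  fromℚ-0 = zeroˡ _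

  open Algebra.Definitions.RawMonoid ℤ.+-0-rawMonoid using () renaming (sum to sumℤ)

  sum-linear : ∀ {n} (e za zb : Fin n → ℤ) x y →
    sumℝ (λ j → fromℤ (e j) * (fromℤ (za j) * x + fromℤ (zb j) * y)) ≈
    fromℤ (sumℤ (λ j → e j ℤ.* za j)) * x + fromℤ (sumℤ (λ j → e j ℤ.* zb j)) * y
  sum-linear {zero}  e za zb x y = solve 2 (λ x y → con 0ℤ := con 0ℤ :* x :+ con 0ℤ :* y) refl x y
  sum-linear {suc n} e za zb x y = trans (+-congˡ (sum-linear (e ∘ Fin.suc) (za ∘ Fin.suc) (zb ∘ Fin.suc) x y))
    (trans (solve 7 (λ e a b s t x y → e :* (a :* x :+ b :* y) :+ (s :* x :+ t :* y)
                                    := (e :* a :+ s) :* x :+ (e :* b :+ t) :* y) refl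
             (fromℤ (e Fin.zero)) (fromℤ (za Fin.zero)) (fromℤ (zb Fin.zero)) (fromℤ A) (fromℤ B) x y)
      (+-cong (*-congʳ (step za A)) (*-congʳ (step zb B))))
    where
    A = sumℤ (λ j → e (Fin.suc j) ℤ.* za (Fin.suc j))
    B = sumℤ (λ j → e (Fin.suc j) ℤ.* zb (Fin.suc j))
    step : ∀ (z : Fin (suc n) → ℤ) s → fromℤ (e Fin.zero) * fromℤ (z Fin.zero) + fromℤ s ≈ fromℤ (e Fin.zero ℤ.* z Fin.zero ℤ.+ s)
    step z s = trans (+-congʳ (sym (fromℤ-* (e Fin.zero) (z Fin.zero)))) (sym (fromℤ-+ (e Fin.zero ℤ.* z Fin.zero) s))

-- Nonzero integer frequencies from the minimal maximum frequency.

module Integerization {r ℓ₁ ℓ₂} (R : Reals r ℓ₁ ℓ₂) where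
  open Reals R
  open Analysis R
  open RealLemmas R

  foldr-∧-≤ : ∀ {a} {A : Set a} (g : A → ℝ) y {e xs} → e ∈ xs → foldr _∧_ y (map g xs) ≤ g e
  foldr-∧-≤ g y (here ≡.refl) = proj₁ (∧-inf _ _)
  foldr-∧-≤ g y (there e∈xs)  = ≤-trans (proj₁ (proj₂ (∧-inf _ _))) (foldr-∧-≤ g y e∈xs)

  minMaxFreq-≤ : ∀ {n} (a b : Fin n → ℝ) {e} → e ∈ freqVectors n → minMaxFreq a b ≤ ∣ freq a e ∣ ∨ ∣ freq b e ∣
  minMaxFreq-≤ a b = foldr-∧-≤ (λ e → ∣ freq a e ∣ ∨ ∣ freq b e ∣) _

  -- Constructively a bound by a join does not single out one of its arguments. For a refutation,
  -- however, y and z may be taken as comparable, and then the join is at most the larger of them.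
  ≤∨⇒¬¬≤⊎≤ : ∀ {x y z} → x ≤ y ∨ z → ¬ x ≤ y → ¬ x ≤ z → ⊥
  ≤∨⇒¬¬≤⊎≤ {x} {y} {z} x≤y∨z x≰y x≰z = x≰y λ y<x → x≰z λ z<x → ≤∨ y<x z<x
    where
    ∨≤ : ∀ {w} → y ≤ w → z ≤ w → y ∨ z ≤ w
    ∨≤ {w} = proj₂ (proj₂ (∨-sup y z)) w
    ≤∨ : y < x → z < x → ⊥
    ≤∨ y<x z<x = ¬¬total λ
      { (inj₁ y≤z) → ≤-trans x≤y∨z (∨≤ y≤z ≤-refl) z<x
      ; (inj₂ z≤y) → ≤-trans x≤y∨z (∨≤ ≤-refl z≤y) y<x }
      where
      ¬¬total : ¬ ¬ (y ≤ z ⊎ z ≤ y)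
      ¬¬total ¬total = ¬total (inj₁ λ z<y → ¬total (inj₂ (<-asym z<y)))

  -- Equality of integers is decidable, so the disjunction is decided on the integer side, and the
  -- real estimate only has to refute the case in which both frequencies vanish.
  nonzero-frequency : ∀ {n} {a b : Fin n → ℝ} {za zb} → IsIntegerization a b za zb →
    ∀ {e} → e ∈ freqVectors n → freqℤ za e ≢ 0ℤ ⊎ freqℤ zb e ≢ 0ℤ
  nonzero-frequency {a = a} {b} {za} {zb} isInt {e} e∈ with freqℤ za e ℤ.≟ 0ℤ | freqℤ zb e ℤ.≟ 0ℤ
  ... | no A≢0   | _        = inj₁ A≢0
  ... | yes _    | no B≢0   = inj₂ B≢0
  ... | yes A≡0  | yes B≡0  = ⊥-elim (≤∨⇒¬¬≤⊎≤ (minMaxFreq-≤ a b e∈)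
    (λ μ≤ → IsIntegerization.nonzero-a isInt e e∈ μ≤ A≡0)
    (λ μ≤ → IsIntegerization.nonzero-b isInt e e∈ μ≤ B≡0))

-- Double sums over the grid.

module Averaging {r ℓ₁ ℓ₂} (R : Reals r ℓ₁ ℓ₂)
    (exp : Analysis.ℂ R → Analysis.ℂ R) (isExp : Analysis.IsExponential R exp) (π : Reals.ℝ R) (isPi : Analysis.IsPi R exp π)
                 (l : ℕ) .{{_ : ℕ.NonZero l}} where
  open Reals R
  open Analysis R
  open RealLemmas R
  open Complex R
  open Circle R exp isExp
  open RootsOfUnity R exp isExp π isPi
  open Numbers R
  open Integerization R
  open ℝ.Solver
  open ℂ-Lemmas using () renaming (∑ to ∑ᶜ)

  ∑² : (ℕ → ℕ → ℂ) → ℂ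
  ∑² g = Σ₁[ m₁ ≤ l ] Σ₁[ m₂ ≤ l ] g m₁ m₂

  ∑²-cong : ∀ {g h} → (∀ m₁ m₂ → g m₁ m₂ ≈ᶜ h m₁ m₂) → ∑² g ≈ᶜ ∑² h
  ∑²-cong g≈h = ℂ-Lemmas.∑-cong l (λ i → ℂ-Lemmas.∑-cong l (λ j → g≈h (suc i) (suc j)))

  ∑²-+ : ∀ g h → ∑² (λ m₁ m₂ → g m₁ m₂ +ᶜ h m₁ m₂) ≈ᶜ ∑² g +ᶜ ∑² h
  ∑²-+ g h = ℂ-Ring.trans
    (ℂ-Lemmas.∑-cong l (λ i → ℂ-Lemmas.∑-distrib-+ {l} (λ j → g (suc i) (suc (toℕ j))) (λ j → h (suc i) (suc (toℕ j)))))
    (ℂ-Lemmas.∑-distrib-+ {l} (λ i → ∑ᶜ (λ j → g (suc (toℕ i)) (suc j)) l) (λ i → ∑ᶜ (λ j → h (suc (toℕ i)) (suc j)) l))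

  ∑²-*ˡ : ∀ z g → ∑² (λ m₁ m₂ → z *ᶜ g m₁ m₂) ≈ᶜ z *ᶜ ∑² g
  ∑²-*ˡ z g = ℂ-Ring.trans
    (ℂ-Lemmas.∑-cong l (λ i → ℂ-Ring.sym (ℂ-Lemmas.*-distribˡ-∑ z (λ j → g (suc i) (suc j)) l)))
    (ℂ-Ring.sym (ℂ-Lemmas.*-distribˡ-∑ z (λ i → ∑ᶜ (λ j → g (suc i) (suc j)) l) l))

  ∑²-product : ∀ g h → ∑² (λ m₁ m₂ → g m₁ *ᶜ h m₂) ≈ᶜ ∑ᶜ (g ∘ suc) l *ᶜ ∑ᶜ (h ∘ suc) l
  ∑²-product g h = ℂ-Ring.trans
    (ℂ-Lemmas.∑-cong l (λ i → ℂ-Ring.sym (ℂ-Lemmas.*-distribˡ-∑ (g (suc i)) (h ∘ suc) l)))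
    (ℂ-Ring.sym (ℂ-Lemmas.*-distribʳ-sum {l} (∑ᶜ (h ∘ suc) l) (λ i → g (suc (toℕ i)))))

  ∑²-0 : ∑² (λ _ _ → 0ᶜ) ≈ᶜ 0ᶜ
  ∑²-0 = ℂ-Ring.trans (∑²-cong (λ _ _ → ℂ-Ring.sym (ℂ-Ring.zeroˡ 0ᶜ)))
    (ℂ-Ring.trans (∑²-*ˡ 0ᶜ (λ _ _ → 0ᶜ)) (ℂ-Ring.zeroˡ _))

  wave : ℤ → ℤ → ℕ → ℕ → ℂ
  wave A B m₁ m₂ = cis (angle l A * fromℕ m₁) *ᶜ cis (angle l B * fromℕ m₂)

  ∑²-wave : ∀ A B → ∑² (wave A B) ≈ᶜ rootSum l A *ᶜ rootSum l B
  ∑²-wave A B = ∑²-product (λ m → cis (angle l A * fromℕ m)) (λ m → cis (angle l B * fromℕ m))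

  ∑²-wave-0 : ∑² (wave 0ℤ 0ℤ) ≈ᶜ fromℝ (fromℕ (l ℕ.^ 2))
  ∑²-wave-0 = ℂ-Ring.trans (∑²-wave 0ℤ 0ℤ) (ℂ-Ring.trans (ℂ-Ring.*-cong (rootSum-0 l) (rootSum-0 l))
    (ℂ-Ring.trans (ℂ-Ring.sym (fromℝ-* _ _)) (fromℝ-cong (trans (sym (ℝ.×1-homo-* l l))
      (reflexive (≡.cong (λ k → fromℕ (l ℕ.* k)) (≡.sym (ℕ.*-identityʳ l))))))))

  module _ {n} (za zb : Fin n → ℤ) where

    wave-e : Vec ℤ n → ℕ → ℕ → ℂ
    wave-e e = wave (freqℤ za e) (freqℤ zb e)

    ∑²-wave≈0 : ∀ {a b} → IsIntegerization a b za zb → maxFreqℤ za zb ℕ.< l →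
                ∀ {e} → e ∈ freqVectors n → ∑² (wave-e e) ≈ᶜ 0ᶜ
    ∑²-wave≈0 isInt max<l {e} e∈ = ℂ-Ring.trans (∑²-wave A B) (vanish (nonzero-frequency isInt e∈))
      where
      A B : ℤ
      A = freqℤ za e
      B = freqℤ zb e

      A⊔B<l : ℤ.∣ A ∣ ℕ.⊔ ℤ.∣ B ∣ ℕ.< l
      A⊔B<l = ℕ.≤-<-trans (maxFreqℤ-bound za zb e∈) max<l

      vanish : A ≢ 0ℤ ⊎ B ≢ 0ℤ → rootSum l A *ᶜ rootSum l B ≈ᶜ 0ᶜ
      vanish (inj₁ A≢0) = ℂ-Ring.trans
        (ℂ-Ring.*-congʳ {rootSum l B} (rootSum≈0 l A A≢0 (ℕ.m⊔n<o⇒m<o ℤ.∣ A ∣ ℤ.∣ B ∣ A⊔B<l))) (ℂ-Ring.zeroˡ _)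
      vanish (inj₂ B≢0) = ℂ-Ring.trans
        (ℂ-Ring.*-congˡ {rootSum l A} (rootSum≈0 l B B≢0 (ℕ.m⊔n<o⇒n<o ℤ.∣ A ∣ ℤ.∣ B ∣ A⊔B<l))) (ℂ-Ring.zeroʳ _)

    node : ℕ → ℝ
    node m = 2π * 1/fromℕ l * fromℕ m

    phase : ℕ → ℕ → Fin n → ℝ
    phase m₁ m₂ j = fromℤ (za j) * node m₁ + fromℤ (zb j) * node m₂

    product-cis : ∀ {k} (F : Fin k → ℂ) t → (∀ j → F j ≈ᶜ cis (t j)) → productᶜ F ≈ᶜ cis (sumℝ t)
    product-cis {zero}  F t F≈ = ℂ-Ring.sym cis-0
    product-cis {suc k} F t F≈ = ℂ-Ring.trans
      (ℂ-Ring.*-cong (F≈ Fin.zero) (product-cis (F ∘ Fin.suc) (t ∘ Fin.suc) (F≈ ∘ Fin.suc)))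
      (ℂ-Ring.sym (cis-+ (t Fin.zero) (sumℝ (t ∘ Fin.suc))))

    X : ℕ → ℕ → Fin n → ℂ
    X m₁ m₂ j = cis (phase m₁ m₂ j)

    X-isUnit : ∀ m₁ m₂ j → IsUnit (X m₁ m₂ j)
    X-isUnit m₁ m₂ j = cis-isUnit (phase m₁ m₂ j)

    monomial : Vec ℤ n → ℕ → ℕ → ℂ
    monomial e m₁ m₂ = productᶜ (λ j → zpow (X m₁ m₂ j) (X-isUnit m₁ m₂ j) (lookup e j))

    monomial≈wave : ∀ e m₁ m₂ → monomial e m₁ m₂ ≈ᶜ wave-e e m₁ m₂
    monomial≈wave e m₁ m₂ = ℂ-Ring.trans
      (product-cis _ (λ j → fromℤ (lookup e j) * phase m₁ m₂ j) (λ j → zpow-cis (phase m₁ m₂ j) (lookup e j)))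
      (ℂ-Ring.trans (cis-cong (trans (sum-linear (lookup e) za zb (node m₁) (node m₂))
          (+-cong (regroup (freqℤ za e) m₁) (regroup (freqℤ zb e) m₂))))
        (cis-+ (angle l (freqℤ za e) * fromℕ m₁) (angle l (freqℤ zb e) * fromℕ m₂)))
      where
      regroup : ∀ k m → fromℤ k * node m ≈ angle l k * fromℕ m
      regroup k m = solve 4 (λ k p r m → k :* (p :* r :* m) := p :* k :* r :* m) refl (fromℤ k) 2π (1/fromℕ l) (fromℕ m)

    ∑²-monomial : ∀ e → ∑² (monomial e) ≈ᶜ ∑² (wave-e e)
    ∑²-monomial e = ∑²-cong (monomial≈wave e)

    -- Evaluation and constant term are both additive along the list, which permits an induction on
    -- the terms. The claim therefore covers every list with exponents -1, 0 or 1, since the tails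
    -- of a logical form are not logical forms.
    ∑²-eval : ∀ {a b} → IsIntegerization a b za zb → maxFreqℤ za zb ℕ.< l →
              ∀ f → All (λ t → ∀ j → SignExponent (lookup (proj₂ t) j)) f →
              ∑² (λ m₁ m₂ → eval f (X m₁ m₂) (X-isUnit m₁ m₂)) ≈ᶜ fromℝ (fromℕ (l ℕ.^ 2) * fromℚ (constantTerm f))
    ∑²-eval isInt max<l [] [] = ℂ-Ring.trans ∑²-0
      (fromℝ-cong (sym (trans (*-congˡ fromℚ-0) (zeroʳ _))))
    ∑²-eval isInt max<l ((q , d) ∷ f) (sign ∷ signs) = ℂ-Ring.trans
      (∑²-+ (λ m₁ m₂ → fromℝ (fromℚ q) *ᶜ monomial d m₁ m₂) (λ m₁ m₂ → eval f (X m₁ m₂) (X-isUnit m₁ m₂)))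
      (ℂ-Ring.trans
        (ℂ-Ring.+-cong
          (ℂ-Ring.trans (∑²-*ˡ (fromℝ (fromℚ q)) (monomial d)) (ℂ-Ring.*-congˡ {fromℝ (fromℚ q)} (∑²-monomial d)))
          (∑²-eval isInt max<l f signs))
        (head-term (coefficient-∷ (replicate n 0ℤ) q d f)))
      where
      C₀ : ℚ
      C₀ = constantTerm f
      L : ℝ
      L = fromℕ (l ℕ.^ 2)

      head-term : (d ≡ replicate n 0ℤ × constantTerm ((q , d) ∷ f) ≡ q ℚ.+ C₀) ⊎
                  (d ≢ replicate n 0ℤ × constantTerm ((q , d) ∷ f) ≡ C₀) →
        fromℝ (fromℚ q) *ᶜ ∑² (wave-e d) +ᶜ fromℝ (L * fromℚ C₀) ≈ᶜ fromℝ (L * fromℚ (constantTerm ((q , d) ∷ f)))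
      head-term (inj₁ (d≡0 , c≡q+C₀)) = ℂ-Ring.trans
        (ℂ-Ring.+-congʳ {fromℝ (L * fromℚ C₀)} (ℂ-Ring.trans (ℂ-Ring.*-congˡ {fromℝ (fromℚ q)} wave-0)
          (ℂ-Ring.sym (fromℝ-* (fromℚ q) L))))
        (ℂ-Ring.trans (ℂ-Ring.sym (fromℝ-+ _ _)) (fromℝ-cong
          (trans (solve 3 (λ q c l → q :* l :+ l :* c := l :* (q :+ c)) refl (fromℚ q) (fromℚ C₀) L)
            (*-congˡ (trans (sym (fromℚ-+ q C₀)) (reflexive (≡.cong fromℚ (≡.sym c≡q+C₀))))))))
        where
        wave-0 : ∑² (wave-e d) ≈ᶜ fromℝ L
        wave-0 = ℂ-Ring.trans (ℂ-Ring.reflexive (≡.cong₂ (λ A B → ∑² (wave A B))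
          (≡.trans (≡.cong (freqℤ za) d≡0) (freqℤ-0 za)) (≡.trans (≡.cong (freqℤ zb) d≡0) (freqℤ-0 zb)))) ∑²-wave-0
      head-term (inj₂ (d≢0 , c≡C₀)) = ℂ-Ring.trans
        (ℂ-Ring.+-congʳ {fromℝ (L * fromℚ C₀)} (ℂ-Ring.trans
          (ℂ-Ring.*-congˡ {fromℝ (fromℚ q)} (∑²-wave≈0 isInt max<l (∈-freqVectors d sign d≢0))) (ℂ-Ring.zeroʳ _)))
        (ℂ-Ring.trans (ℂ-Ring.+-identityˡ _)
          (fromℝ-cong (*-congˡ (reflexive (≡.cong fromℚ (≡.sym c≡C₀))))))

theorem17 :
  ∀ {c ℓ₁ ℓ₂} (R : Reals c ℓ₁ ℓ₂) →
  let open Reals R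
      open Analysis R
  in
  (exp : ℂ → ℂ) → IsExponential exp →
  (π : ℝ) → IsPi exp π →
  (M N : ℕ) .{{_ : NonZero M}} (φ : 3CNF M N) →
  let n = M ℕ.* 3
      f = logicalForm φ
      C = constantTerm f
  in
  (a b : Fin n → ℝ) (z′a z′b : Fin n → ℤ) → IsIntegerization a b z′a z′b →
  (l : ℕ) .{{_ : NonZero l}} → maxFreqℤ z′a z′b ℕ.< l →
  let 2π = fromℕ 2 * π
      x : ℕ → ℝ
      x m = 2π * 1/fromℕ l * fromℕ m
      X : ℕ → ℕ → Fin n → ℂ
      X m₁ m₂ j = exp (0# +i (fromℤ (z′a j) * x m₁ + fromℤ (z′b j) * x m₂))
  in
  (∀ e → e ∈ freqVectors n →
    Σ₁[ m₁ ≤ l ] Σ₁[ m₂ ≤ l ]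
      (exp (0# +i (2π * fromℤ (freqℤ z′a e) * 1/fromℕ l * fromℕ m₁))
        *ᶜ exp (0# +i (2π * fromℤ (freqℤ z′b e) * 1/fromℕ l * fromℕ m₂)))
      ≈ᶜ 0ᶜ)
  ×
  (Σ[ unit ∈ (∀ m₁ m₂ j → IsUnit (X m₁ m₂ j)) ]
    Σ₁[ m₁ ≤ l ] Σ₁[ m₂ ≤ l ] eval f (X m₁ m₂) (unit m₁ m₂)
      ≈ᶜ fromℝ (fromℕ (l ℕ.^ 2) * fromℚ C))
theorem17 R exp isExp π isPi M N φ a b z′a z′b isInt l max<l =
  (λ e e∈ → ∑²-wave≈0 z′a z′b isInt max<l e∈) ,
  X-isUnit z′a z′b ,
  ∑²-eval z′a z′b isInt max<l (logicalForm φ) (all (logicalForm-exponents φ))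
  where open Averaging R exp isExp π isPi l
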